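{- Let $p,t\geq 1$ be integers and let $m,n$ be even positive integers with $m\leq n$. Let $G$ be a regular graph of order $p$. If (i) $m+n\equiv 0\pmod 4$ and (ii) $1=2(2ptn+1)^2-(2ptm+2ptn+1)^2$ or $m\geq(\sqrt2-1)n+\frac{\sqrt2-1}{2pt}$, then $tK_{m,n}\otimes G$ is distance magic.
   Context: A graph $G$ on $v$ vertices is distance magic if there is a bijection $f:V(G)\to\{1,\ldots,v\}$ and a constant $k$ such that for every vertex $x$, $\sum_{y\in N(x)}f(y)=k$, where $N(x)$ is the set of neighbours of $x$. $K_{m,n}$ is the complete bipartite graph with parts of sizes $m$ and $n$; $tH$ denotes the disjoint union of $t$ copies of $H$. The Kronecker (tensor) product $G\otimes H$ has vertex set $V(G)\times V(H)$, with $(g,h)\sim(g',h')$ iff $gg'\in E(G)$ and $hh'\in E(H)$. -}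

module Defs where

open import Data.Empty using (⊥)
open import Data.Fin using (Fin; toℕ)
import Data.Fin.Properties as Fin
open import Data.Integer using (+_)
import Data.Integer as ℤ
import Data.Integer.Properties as ℤ
open import Data.List using (List; length; map; filter; allFin)
open import Data.Nat.ListAction using (sum)
open import Data.Nat using (ℕ; zero; suc; NonZero)
import Data.Nat as ℕ
import Data.Nat.Properties as ℕ
import Data.Nat.Tactic.RingSolver as ℕSolver
open import Data.Product using (Σ; ∃-syntax; _×_; _,_; proj₁; proj₂)
open import Data.Product.Function.NonDependent.Propositional using (_×-↔_)
open import Data.Rational using (ℚ; mkℚ; 0ℚ; 1ℚ)
import Data.Rational as ℚ
import Data.Rational.Properties as ℚ
import Data.Rational.Unnormalised as ℚᵘ
import Data.Rational.Unnormalised.Properties as ℚᵘ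
open import Data.Rational.Solver using (module +-*-Solver)
open import Data.Sum using (_⊎_; inj₁; inj₂)
open import Data.Unit using (⊤; tt)
open import Function using (_↔_; _⤖_)
open import Function.Bundles using (Inverse; Bijection)
import Function.Properties.Inverse as Inv
open import Relation.Binary.PropositionalEquality using (_≡_; refl; sym; trans; cong; cong₂; subst; subst₂; module ≡-Reasoning)
open import Relation.Nullary using (¬_; Dec; yes; no; contradiction)
open import Relation.Nullary.Decidable using (_×-dec_)

record Graph (v : ℕ) : Set₁ where
  field
    V        : Set
    index    : V ↔ Fin v
    _~_      : V → V → Set
    _~?_     : ∀ x y → Dec (x ~ y)
    ~-sym    : ∀ {x y} → x ~ y → y ~ x
    ~-irrefl : ∀ {x} → ¬ (x ~ x)

  vertices : List V
  vertices = map (Inverse.from index) (allFin v)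

  neighbours : V → List V
  neighbours x = filter (x ~?_) vertices

  degree : V → ℕ
  degree x = length (neighbours x)

open Graph

Regular : ∀ {v} → Graph v → Set
Regular G = ∃[ r ] ∀ x → degree G x ≡ r

DistanceMagic : ∀ {v} → Graph v → Set
DistanceMagic {v} G =
  Σ (V G ⤖ Fin v) λ f →
    -- Fin v is {0,…,v-1}, so the labels are shifted to {1,…,v}.
    let label : V G → ℕ
        label x = suc (toℕ (Bijection.to f x))
    in ∃[ k ] ∀ x → sum (map label (neighbours G x)) ≡ k

K : ∀ m n → Graph (m ℕ.+ n)
K m n = record
  { V        = Fin m ⊎ Fin n
  ; index    = Inv.↔-sym Fin.+↔⊎
  ; _~_      = adj
  ; _~?_     = adj?
  ; ~-sym    = λ {x} {y} → adj-sym x y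
  ; ~-irrefl = λ {x} → adj-irrefl x
  }
  where
  adj : Fin m ⊎ Fin n → Fin m ⊎ Fin n → Set
  adj (inj₁ _) (inj₁ _) = ⊥
  adj (inj₁ _) (inj₂ _) = ⊤
  adj (inj₂ _) (inj₁ _) = ⊤
  adj (inj₂ _) (inj₂ _) = ⊥

  adj? : ∀ x y → Dec (adj x y)
  adj? (inj₁ _) (inj₁ _) = no λ ()
  adj? (inj₁ _) (inj₂ _) = yes tt
  adj? (inj₂ _) (inj₁ _) = yes tt
  adj? (inj₂ _) (inj₂ _) = no λ ()

  adj-sym : ∀ x y → adj x y → adj y x
  adj-sym (inj₁ _) (inj₂ _) _ = tt
  adj-sym (inj₂ _) (inj₁ _) _ = tt

  adj-irrefl : ∀ x → ¬ adj x x
  adj-irrefl (inj₁ _) ()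
  adj-irrefl (inj₂ _) ()

infixl 8 _·_
infixl 7 _⊗_

-- t · H is the disjoint union of t copies of H.
_·_ : ∀ {v} (t : ℕ) → Graph v → Graph (t ℕ.* v)
t · H = record
  { V        = Fin t × V H
  ; index    = Inv.↔-trans (Inv.↔-refl ×-↔ index H) (Inv.↔-sym Fin.*↔×)
  ; _~_      = λ (i , x) (j , y) → i ≡ j × _~_ H x y
  ; _~?_     = λ (i , x) (j , y) → (i Fin.≟ j) ×-dec (_~?_ H x y)
  ; ~-sym    = λ (i≡j , x~y) → sym i≡j , ~-sym H x~y
  ; ~-irrefl = λ (_ , x~x) → ~-irrefl H x~x
  }

_⊗_ : ∀ {v w} → Graph v → Graph w → Graph (v ℕ.* w)
G ⊗ H = record
  { V        = V G × V H
  ; index    = Inv.↔-trans (index G ×-↔ index H) (Inv.↔-sym Fin.*↔×)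
  ; _~_      = λ (g , h) (g′ , h′) → _~_ G g g′ × _~_ H h h′
  ; _~?_     = λ (g , h) (g′ , h′) → (_~?_ G g g′) ×-dec (_~?_ H h h′)
  ; ~-sym    = λ (p , q) → ~-sym G p , ~-sym H q
  ; ~-irrefl = λ (p , _) → ~-irrefl G p
  }

-- Cauchy reals; equality is the setoid relation _≃ℝ_.
record ℝ : Set where
  constructor mkℝ
  field
    seq    : ℕ → ℚ
    cauchy : ∀ ε → 0ℚ ℚ.< ε →
             ∃[ N ] ∀ i j → N ℕ.≤ i → N ℕ.≤ j → ℚ.∣ seq i ℚ.- seq j ∣ ℚ.< ε

open ℝ

infix 4 _≃ℝ_ _≤ℝ_ _≥ℝ_

_≃ℝ_ : ℝ → ℝ → Set
x ≃ℝ y = ∀ ε → 0ℚ ℚ.< ε →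
  ∃[ N ] ∀ i → N ℕ.≤ i → ℚ.∣ seq x i ℚ.- seq y i ∣ ℚ.< ε

_≤ℝ_ : ℝ → ℝ → Set
x ≤ℝ y = ∀ ε → 0ℚ ℚ.< ε →
  ∃[ N ] ∀ i → N ℕ.≤ i → seq x i ℚ.< seq y i ℚ.+ ε

_≥ℝ_ : ℝ → ℝ → Set
x ≥ℝ y = y ≤ℝ x

private
  half+half : ∀ ε → ε ℚ.* ℚ.½ ℚ.+ ε ℚ.* ℚ.½ ≡ ε
  half+half ε = trans (sym (ℚ.*-distribˡ-+ ε ℚ.½ ℚ.½)) (ℚ.*-identityʳ ε)

  *-pos : ∀ {p q} → 0ℚ ℚ.< p → 0ℚ ℚ.< q → 0ℚ ℚ.< p ℚ.* q
  *-pos {p} {q} 0<p 0<q = ℚ.positive⁻¹ (p ℚ.* q)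
    {{ℚ.pos*pos⇒pos p {{ℚ.positive 0<p}} q {{ℚ.positive 0<q}}}}

  half-pos : ∀ {ε} → 0ℚ ℚ.< ε → 0ℚ ℚ.< ε ℚ.* ℚ.½
  half-pos 0<ε = *-pos 0<ε (ℚ.positive⁻¹ ℚ.½)

  p-p≡0 : ∀ p → p ℚ.- p ≡ 0ℚ
  p-p≡0 = ℚ.+-inverseʳ

fromℚ : ℚ → ℝ
fromℚ q = mkℝ (λ _ → q) λ ε 0<ε →
  0 , λ _ _ _ _ → subst (λ r → ℚ.∣ r ∣ ℚ.< ε) (sym (p-p≡0 q)) 0<ε

fromℕ : ℕ → ℝ
fromℕ n = fromℚ (+ n ℚ./ 1)

0ℝ 1ℝ : ℝ
0ℝ = fromℕ 0
1ℝ = fromℕ 1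

infix  8 -ℝ_
infixl 7 _*ℝ_ _/ℝ_
infixl 6 _+ℝ_ _-ℝ_

_+ℝ_ : ℝ → ℝ → ℝ
x +ℝ y = mkℝ (λ i → seq x i ℚ.+ seq y i) λ ε 0<ε →
  let M , hM = cauchy x (ε ℚ.* ℚ.½) (half-pos 0<ε)
      N , hN = cauchy y (ε ℚ.* ℚ.½) (half-pos 0<ε)
  in M ℕ.⊔ N , λ i j p q →
    let open ℚ.≤-Reasoning
        a = seq x i
        b = seq y i
        c = seq x j
        d = seq y j
    in begin-strict
      ℚ.∣ (a ℚ.+ b) ℚ.- (c ℚ.+ d) ∣
        ≡⟨ cong ℚ.∣_∣ (regroup a b c d) ⟩
      ℚ.∣ (a ℚ.- c) ℚ.+ (b ℚ.- d) ∣
        ≤⟨ ℚ.∣p+q∣≤∣p∣+∣q∣ (a ℚ.- c) (b ℚ.- d) ⟩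
      ℚ.∣ a ℚ.- c ∣ ℚ.+ ℚ.∣ b ℚ.- d ∣
        <⟨ ℚ.+-mono-< (hM i j (ℕ.m⊔n≤o⇒m≤o M N p) (ℕ.m⊔n≤o⇒m≤o M N q))
                      (hN i j (ℕ.m⊔n≤o⇒n≤o M N p) (ℕ.m⊔n≤o⇒n≤o M N q)) ⟩
      ε ℚ.* ℚ.½ ℚ.+ ε ℚ.* ℚ.½
        ≡⟨ half+half ε ⟩
      ε ∎
  where
  regroup : ∀ a b c d → (a ℚ.+ b) ℚ.- (c ℚ.+ d) ≡ (a ℚ.- c) ℚ.+ (b ℚ.- d)
  regroup = solve 4 (λ a b c d → (a :+ b) :- (c :+ d) := (a :- c) :+ (b :- d)) refl
    where open +-*-Solver

-ℝ_ : ℝ → ℝ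
-ℝ x = mkℝ (λ i → ℚ.- seq x i) λ ε 0<ε →
  let N , h = cauchy x ε 0<ε
  in N , λ i j p q → subst (ℚ._< ε) (flip-abs (seq x i) (seq x j)) (h i j p q)
  where
  flip-abs : ∀ a b → ℚ.∣ a ℚ.- b ∣ ≡ ℚ.∣ (ℚ.- a) ℚ.- (ℚ.- b) ∣
  flip-abs a b = trans (sym (ℚ.∣-p∣≡∣p∣ (a ℚ.- b))) (cong ℚ.∣_∣ (ℚ.neg-distrib-+ a (ℚ.- b)))

_-ℝ_ : ℝ → ℝ → ℝ
x -ℝ y = x +ℝ (-ℝ y)

private
  bound : (x : ℝ) → ∃[ B ] 0ℚ ℚ.< B × ∃[ N ] ∀ i → N ℕ.≤ i → ℚ.∣ seq x i ∣ ℚ.≤ B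
  bound x with cauchy x 1ℚ (ℚ.positive⁻¹ 1ℚ)
  ... | N , h = B , 0<B , N , λ i p → let open ℚ.≤-Reasoning; a = seq x i in begin
      ℚ.∣ a ∣                        ≡⟨ cong ℚ.∣_∣ (split a c) ⟩
      ℚ.∣ c ℚ.+ (a ℚ.- c) ∣          ≤⟨ ℚ.∣p+q∣≤∣p∣+∣q∣ c (a ℚ.- c) ⟩
      ℚ.∣ c ∣ ℚ.+ ℚ.∣ a ℚ.- c ∣      ≤⟨ ℚ.+-monoʳ-≤ ℚ.∣ c ∣ (ℚ.<⇒≤ (h i N p ℕ.≤-refl)) ⟩
      B                              ∎
    where
    c = seq x N
    B = ℚ.∣ c ∣ ℚ.+ 1ℚ
    0<B : 0ℚ ℚ.< B
    0<B = ℚ.+-mono-≤-< (ℚ.0≤∣p∣ c) (ℚ.positive⁻¹ 1ℚ)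
    split : ∀ a c → a ≡ c ℚ.+ (a ℚ.- c)
    split = solve 2 (λ a c → a := c :+ (a :- c)) refl
      where open +-*-Solver

  divide : ∀ {ε D} → 0ℚ ℚ.< ε → 0ℚ ℚ.< D → ∃[ δ ] 0ℚ ℚ.< δ × D ℚ.* δ ≡ ε
  divide {ε} {D} 0<ε 0<D = ε ℚ.* D⁻¹ , *-pos 0<ε 0<D⁻¹ , (begin
      D ℚ.* (ε ℚ.* D⁻¹)   ≡⟨ shuffle D ε D⁻¹ ⟩
      ε ℚ.* (D ℚ.* D⁻¹)   ≡⟨ cong (ε ℚ.*_) (ℚ.*-inverseʳ D {{D≢0}}) ⟩
      ε ℚ.* 1ℚ            ≡⟨ ℚ.*-identityʳ ε ⟩
      ε                   ∎)
    where
    open ≡-Reasoning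
    D>0 = ℚ.positive 0<D
    D≢0 = ℚ.pos⇒nonZero D {{D>0}}
    D⁻¹ = ℚ.1/_ D {{D≢0}}
    0<D⁻¹ : 0ℚ ℚ.< D⁻¹
    0<D⁻¹ = ℚ.positive⁻¹ D⁻¹ {{ℚ.1/pos⇒pos D {{D>0}}}}
    shuffle : ∀ a b c → a ℚ.* (b ℚ.* c) ≡ b ℚ.* (a ℚ.* c)
    shuffle = solve 3 (λ a b c → a :* (b :* c) := b :* (a :* c)) refl
      where open +-*-Solver

private
  term : ∀ {A δ} a e → 0ℚ ℚ.< A → ℚ.∣ a ∣ ℚ.≤ A → ℚ.∣ e ∣ ℚ.< δ → ℚ.∣ a ℚ.* e ∣ ℚ.< A ℚ.* δ
  term {A} {δ} a e 0<A a≤A e<δ = begin-strict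
      ℚ.∣ a ℚ.* e ∣           ≡⟨ ℚ.∣p*q∣≡∣p∣*∣q∣ a e ⟩
      ℚ.∣ a ∣ ℚ.* ℚ.∣ e ∣     ≤⟨ ℚ.*-monoʳ-≤-nonNeg ℚ.∣ e ∣ {{ℚ.∣-∣-nonNeg e}} a≤A ⟩
      A ℚ.* ℚ.∣ e ∣           <⟨ ℚ.*-monoʳ-<-pos A {{ℚ.positive 0<A}} e<δ ⟩
      A ℚ.* δ                 ∎
    where open ℚ.≤-Reasoning

  product-close : ∀ {B C δ ε} a b c d → 0ℚ ℚ.< B → 0ℚ ℚ.< C → (B ℚ.+ C) ℚ.* δ ≡ ε →
                  ℚ.∣ a ∣ ℚ.≤ B → ℚ.∣ d ∣ ℚ.≤ C → ℚ.∣ b ℚ.- d ∣ ℚ.< δ → ℚ.∣ a ℚ.- c ∣ ℚ.< δ →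
                  ℚ.∣ a ℚ.* b ℚ.- c ℚ.* d ∣ ℚ.< ε
  product-close {B} {C} {δ} {ε} a b c d 0<B 0<C eq a≤B d≤C b-d a-c = begin-strict
      ℚ.∣ a ℚ.* b ℚ.- c ℚ.* d ∣
        ≡⟨ cong ℚ.∣_∣ (regroup a b c d) ⟩
      ℚ.∣ a ℚ.* (b ℚ.- d) ℚ.+ d ℚ.* (a ℚ.- c) ∣
        ≤⟨ ℚ.∣p+q∣≤∣p∣+∣q∣ (a ℚ.* (b ℚ.- d)) (d ℚ.* (a ℚ.- c)) ⟩
      ℚ.∣ a ℚ.* (b ℚ.- d) ∣ ℚ.+ ℚ.∣ d ℚ.* (a ℚ.- c) ∣
        <⟨ ℚ.+-mono-< (term a (b ℚ.- d) 0<B a≤B b-d) (term d (a ℚ.- c) 0<C d≤C a-c) ⟩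
      B ℚ.* δ ℚ.+ C ℚ.* δ
        ≡⟨ ℚ.*-distribʳ-+ δ B C ⟨
      (B ℚ.+ C) ℚ.* δ
        ≡⟨ eq ⟩
      ε ∎
    where
    open ℚ.≤-Reasoning
    regroup : ∀ a b c d → a ℚ.* b ℚ.- c ℚ.* d ≡ a ℚ.* (b ℚ.- d) ℚ.+ d ℚ.* (a ℚ.- c)
    regroup = solve 4 (λ a b c d → a :* b :- c :* d := a :* (b :- d) :+ d :* (a :- c)) refl
      where open +-*-Solver

_*ℝ_ : ℝ → ℝ → ℝ
x *ℝ y = mkℝ (λ i → seq x i ℚ.* seq y i) λ ε 0<ε →
  let B , 0<B , M₀ , x≤B = bound x
      C , 0<C , N₀ , y≤C = bound y
      δ , 0<δ , eq = divide 0<ε (ℚ.+-mono-< 0<B 0<C)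
      M , hM = cauchy x δ 0<δ
      N , hN = cauchy y δ 0<δ
  in (M₀ ℕ.⊔ N₀) ℕ.⊔ (M ℕ.⊔ N) , λ i j p q →
    let p₀ = ℕ.m⊔n≤o⇒m≤o (M₀ ℕ.⊔ N₀) (M ℕ.⊔ N) p
        q₀ = ℕ.m⊔n≤o⇒m≤o (M₀ ℕ.⊔ N₀) (M ℕ.⊔ N) q
        p₁ = ℕ.m⊔n≤o⇒n≤o (M₀ ℕ.⊔ N₀) (M ℕ.⊔ N) p
        q₁ = ℕ.m⊔n≤o⇒n≤o (M₀ ℕ.⊔ N₀) (M ℕ.⊔ N) q
    in product-close (seq x i) (seq y i) (seq x j) (seq y j) 0<B 0<C eq
         (x≤B i (ℕ.m⊔n≤o⇒m≤o M₀ N₀ p₀))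
         (y≤C j (ℕ.m⊔n≤o⇒n≤o M₀ N₀ q₀))
         (hN i j (ℕ.m⊔n≤o⇒n≤o M N p₁) (ℕ.m⊔n≤o⇒n≤o M N q₁))
         (hM i j (ℕ.m⊔n≤o⇒m≤o M N p₁) (ℕ.m⊔n≤o⇒m≤o M N q₁))

_/ℝ_ : ℝ → (k : ℕ) → .{{NonZero k}} → ℝ
x /ℝ k = x *ℝ fromℚ (+ 1 ℚ./ k)

-- isqrt n = ⌊√n⌋
isqrt : ℕ → ℕ
isqrt zero = zero
isqrt (suc n) with suc (isqrt n) ℕ.* suc (isqrt n) ℕ.≤? suc n
... | yes _ = suc (isqrt n)
... | no  _ = isqrt n

isqrt-lower : ∀ n → isqrt n ℕ.* isqrt n ℕ.≤ n
isqrt-lower zero = ℕ.z≤n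
isqrt-lower (suc n) with suc (isqrt n) ℕ.* suc (isqrt n) ℕ.≤? suc n
... | yes p = p
... | no  _ = ℕ.m≤n⇒m≤1+n (isqrt-lower n)

isqrt-upper : ∀ n → n ℕ.< suc (isqrt n) ℕ.* suc (isqrt n)
isqrt-upper zero = ℕ.s≤s ℕ.z≤n
isqrt-upper (suc n) with suc (isqrt n) ℕ.* suc (isqrt n) ℕ.≤? suc n
... | yes p = ℕ.≤-<-trans (isqrt-upper n)
                (ℕ.*-mono-< (ℕ.n<1+n (suc (isqrt n))) (ℕ.n<1+n (suc (isqrt n))))
... | no ¬p = ℕ.≰⇒> ¬p

-- ⌊√(n (k+1)²)⌋ / (k+1), which is within 1/(k+1) of the square root of n
√-approx : ℕ → ℕ → ℚ
√-approx n k = + isqrt (n ℕ.* (suc k ℕ.* suc k)) ℚ./ suc k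

module ApproxLemmas where
  root : ℕ → ℕ → ℕ
  root n k = isqrt (n ℕ.* (suc k ℕ.* suc k))

  sq-cancel-< : ∀ a b → a ℕ.* a ℕ.< b ℕ.* b → a ℕ.< b
  sq-cancel-< a b p with a ℕ.<? b
  ... | yes q = q
  ... | no ¬q = contradiction (ℕ.<-≤-trans p (ℕ.*-mono-≤ (ℕ.≮⇒≥ ¬q) (ℕ.≮⇒≥ ¬q))) (ℕ.<-irrefl refl)

  sq-cancel-≤ : ∀ a b → a ℕ.* a ℕ.≤ b ℕ.* b → a ℕ.≤ b
  sq-cancel-≤ a b p with a ℕ.≤? b
  ... | yes q = q
  ... | no ¬q = contradiction (ℕ.≤-<-trans p (ℕ.*-mono-< (ℕ.≰⇒> ¬q) (ℕ.≰⇒> ¬q))) (ℕ.<-irrefl refl)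

  -- both sides compare with n (i+1)² (j+1)²
  root-cross : ∀ n i j → root n i ℕ.* suc j ℕ.< suc (root n j) ℕ.* suc i
  root-cross n i j = sq-cancel-< (r ℕ.* J) (suc s ℕ.* I) (begin-strict
      (r ℕ.* J) ℕ.* (r ℕ.* J)          ≡⟨ swap₁ r J ⟩
      (r ℕ.* r) ℕ.* (J ℕ.* J)          ≤⟨ ℕ.*-monoˡ-≤ (J ℕ.* J) (isqrt-lower (n ℕ.* (I ℕ.* I))) ⟩
      (n ℕ.* (I ℕ.* I)) ℕ.* (J ℕ.* J)  ≡⟨ swap₂ n I J ⟩
      (n ℕ.* (J ℕ.* J)) ℕ.* (I ℕ.* I)  <⟨ ℕ.*-monoˡ-< (I ℕ.* I) (isqrt-upper (n ℕ.* (J ℕ.* J))) ⟩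
      (suc s ℕ.* suc s) ℕ.* (I ℕ.* I)  ≡⟨ swap₁ (suc s) I ⟨
      (suc s ℕ.* I) ℕ.* (suc s ℕ.* I)  ∎)
    where
    open ℕ.≤-Reasoning
    I = suc i
    J = suc j
    r = root n i
    s = root n j
    swap₁ : ∀ a b → (a ℕ.* b) ℕ.* (a ℕ.* b) ≡ (a ℕ.* a) ℕ.* (b ℕ.* b)
    swap₁ = ℕSolver.solve-∀
    swap₂ : ∀ a b c → (a ℕ.* (b ℕ.* b)) ℕ.* (c ℕ.* c) ≡ (a ℕ.* (c ℕ.* c)) ℕ.* (b ℕ.* b)
    swap₂ = ℕSolver.solve-∀

  toℚᵘ-/ : ∀ a b → ℚ.toℚᵘ (+ a ℚ./ suc b) ℚᵘ.≃ ℚᵘ.mkℚᵘ (+ a) b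
  toℚᵘ-/ a b = ℚ.toℚᵘ-fromℚᵘ (ℚᵘ.mkℚᵘ (+ a) b)

  /-mono-< : ∀ a b c d → a ℕ.* suc d ℕ.< c ℕ.* suc b → + a ℚ./ suc b ℚ.< + c ℚ./ suc d
  /-mono-< a b c d p = ℚ.toℚᵘ-cancel-< (begin-strict
      ℚ.toℚᵘ (+ a ℚ./ suc b) ≃⟨ toℚᵘ-/ a b ⟩
      ℚᵘ.mkℚᵘ (+ a) b        <⟨ ℚᵘ.*<* (subst₂ ℤ._<_ (ℤ.pos-* a (suc d)) (ℤ.pos-* c (suc b)) (ℤ.+<+ p)) ⟩
      ℚᵘ.mkℚᵘ (+ c) d        ≃⟨ toℚᵘ-/ c d ⟨
      ℚ.toℚᵘ (+ c ℚ./ suc d) ∎)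
    where open ℚᵘ.≤-Reasoning

  /-mono-≤ : ∀ a b c d → a ℕ.* suc d ℕ.≤ c ℕ.* suc b → + a ℚ./ suc b ℚ.≤ + c ℚ./ suc d
  /-mono-≤ a b c d p = ℚ.toℚᵘ-cancel-≤ (begin
      ℚ.toℚᵘ (+ a ℚ./ suc b) ≃⟨ toℚᵘ-/ a b ⟩
      ℚᵘ.mkℚᵘ (+ a) b        ≤⟨ ℚᵘ.*≤* (subst₂ ℤ._≤_ (ℤ.pos-* a (suc d)) (ℤ.pos-* c (suc b)) (ℤ.+≤+ p)) ⟩
      ℚᵘ.mkℚᵘ (+ c) d        ≃⟨ toℚᵘ-/ c d ⟨
      ℚ.toℚᵘ (+ c ℚ./ suc d) ∎)
    where open ℚᵘ.≤-Reasoning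

  /-+ : ∀ a b c d → (+ a ℚ./ suc b) ℚ.+ (+ c ℚ./ suc d)
                    ≡ + (a ℕ.* suc d ℕ.+ c ℕ.* suc b) ℚ./ (suc b ℕ.* suc d)
  /-+ a b c d = ℚ.toℚᵘ-injective (begin
      ℚ.toℚᵘ ((+ a ℚ./ suc b) ℚ.+ (+ c ℚ./ suc d))
        ≈⟨ ℚ.toℚᵘ-homo-+ (+ a ℚ./ suc b) (+ c ℚ./ suc d) ⟩
      ℚ.toℚᵘ (+ a ℚ./ suc b) ℚᵘ.+ ℚ.toℚᵘ (+ c ℚ./ suc d)
        ≈⟨ ℚᵘ.+-cong (toℚᵘ-/ a b) (toℚᵘ-/ c d) ⟩
      ℚᵘ.mkℚᵘ (+ a) b ℚᵘ.+ ℚᵘ.mkℚᵘ (+ c) d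
        ≡⟨ cong (λ z → ℚᵘ.mkℚᵘ z (d ℕ.+ b ℕ.* suc d))
             (cong₂ ℤ._+_ (sym (ℤ.pos-* a (suc d))) (sym (ℤ.pos-* c (suc b)))) ⟩
      ℚᵘ.mkℚᵘ (+ (a ℕ.* suc d ℕ.+ c ℕ.* suc b)) (d ℕ.+ b ℕ.* suc d)
        ≈⟨ toℚᵘ-/ (a ℕ.* suc d ℕ.+ c ℕ.* suc b) (d ℕ.+ b ℕ.* suc d) ⟨
      ℚ.toℚᵘ (+ (a ℕ.* suc d ℕ.+ c ℕ.* suc b) ℚ./ (suc b ℕ.* suc d)) ∎)
    where open import Relation.Binary.Reasoning.Setoid ℚᵘ.≃-setoid

  /-* : ∀ a b c d → (+ a ℚ./ suc b) ℚ.* (+ c ℚ./ suc d) ≡ + (a ℕ.* c) ℚ./ (suc b ℕ.* suc d)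
  /-* a b c d = ℚ.toℚᵘ-injective (begin
      ℚ.toℚᵘ ((+ a ℚ./ suc b) ℚ.* (+ c ℚ./ suc d))
        ≈⟨ ℚ.toℚᵘ-homo-* (+ a ℚ./ suc b) (+ c ℚ./ suc d) ⟩
      ℚ.toℚᵘ (+ a ℚ./ suc b) ℚᵘ.* ℚ.toℚᵘ (+ c ℚ./ suc d)
        ≈⟨ ℚᵘ.*-cong (toℚᵘ-/ a b) (toℚᵘ-/ c d) ⟩
      ℚᵘ.mkℚᵘ (+ a) b ℚᵘ.* ℚᵘ.mkℚᵘ (+ c) d
        ≡⟨ cong (λ z → ℚᵘ.mkℚᵘ z (d ℕ.+ b ℕ.* suc d)) (sym (ℤ.pos-* a c)) ⟩
      ℚᵘ.mkℚᵘ (+ (a ℕ.* c)) (d ℕ.+ b ℕ.* suc d)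
        ≈⟨ toℚᵘ-/ (a ℕ.* c) (d ℕ.+ b ℕ.* suc d) ⟨
      ℚ.toℚᵘ (+ (a ℕ.* c) ℚ./ (suc b ℕ.* suc d)) ∎)
    where open import Relation.Binary.Reasoning.Setoid ℚᵘ.≃-setoid

  archimedes : ∀ ε → 0ℚ ℚ.< ε → ∃[ N ] ∀ k → N ℕ.≤ k → + 1 ℚ./ suc k ℚ.< ε
  archimedes (mkℚ (ℤ.+ zero) d c) (ℚ.*<* p) = contradiction p (λ { (ℤ.+<+ ()) })
  archimedes (mkℚ (ℤ.-[1+ a ]) d c) (ℚ.*<* ())
  archimedes ε@(mkℚ (ℤ.+ suc a) d c) _ = suc d , λ k p →
    subst (+ 1 ℚ./ suc k ℚ.<_) (ℚ.fromℚᵘ-toℚᵘ ε)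
      (/-mono-< 1 k (suc a) d
        (ℕ.<-≤-trans (ℕ.s≤s (ℕ.≤-trans (ℕ.≤-reflexive (ℕ.+-identityʳ (suc d))) p))
                     (ℕ.m≤m+n (suc k) (a ℕ.* suc k))))

  approx-step : ∀ n i j → √-approx n i ℚ.< √-approx n j ℚ.+ (+ 1 ℚ./ suc j)
  approx-step n i j = subst (√-approx n i ℚ.<_) (sym (/-+ s j 1 j))
    (/-mono-< r i (s ℕ.* J ℕ.+ 1 ℕ.* J) (j ℕ.+ j ℕ.* suc j) (begin-strict
      r ℕ.* (J ℕ.* J)                 ≡⟨ ℕ.*-assoc r J J ⟨
      (r ℕ.* J) ℕ.* J                 <⟨ ℕ.*-monoˡ-< J (root-cross n i j) ⟩
      (suc s ℕ.* suc i) ℕ.* J         ≡⟨ shuffle s (suc i) J ⟩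
      (s ℕ.* J ℕ.+ 1 ℕ.* J) ℕ.* suc i ∎))
    where
    open ℕ.≤-Reasoning
    J = suc j
    r = root n i
    s = root n j
    shuffle : ∀ s i J → (suc s ℕ.* i) ℕ.* J ≡ (s ℕ.* J ℕ.+ 1 ℕ.* J) ℕ.* i
    shuffle = ℕSolver.solve-∀

  ∣-∣-< : ∀ {a b ε} → a ℚ.< b ℚ.+ ε → b ℚ.< a ℚ.+ ε → ℚ.∣ a ℚ.- b ∣ ℚ.< ε
  ∣-∣-< {a} {b} {ε} p q with ℚ.∣p∣≡p∨∣p∣≡-p (a ℚ.- b)
  ... | inj₁ eq = subst (ℚ._< ε) (sym eq)
        (subst (a ℚ.- b ℚ.<_) (cancel b ε) (ℚ.+-monoˡ-< (ℚ.- b) p))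
    where
    open +-*-Solver
    cancel : ∀ b ε → b ℚ.+ ε ℚ.- b ≡ ε
    cancel = solve 2 (λ b ε → b :+ ε :- b := ε) refl
  ... | inj₂ eq = subst (ℚ._< ε) (sym eq)
        (subst₂ ℚ._<_ (neg a b) (cancel a ε) (ℚ.+-monoˡ-< (ℚ.- a) q))
    where
    open +-*-Solver
    cancel : ∀ b ε → b ℚ.+ ε ℚ.- b ≡ ε
    cancel = solve 2 (λ b ε → b :+ ε :- b := ε) refl
    neg : ∀ a b → b ℚ.- a ≡ ℚ.- (a ℚ.- b)
    neg = solve 2 (λ a b → b :- a := :- (a :- b)) refl

open ApproxLemmas

infix 9 √_

√_ : ℕ → ℝ
√ n = mkℝ (√-approx n) λ ε 0<ε →
  let N , h = archimedes ε 0<ε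
  in N , λ i j p q → ∣-∣-<
       (ℚ.<-trans (approx-step n i j) (ℚ.+-monoʳ-< (√-approx n j) (h j q)))
       (ℚ.<-trans (approx-step n j i) (ℚ.+-monoʳ-< (√-approx n i) (h i p)))

√-nonneg : ∀ n → 0ℝ ≤ℝ √ n
√-nonneg n ε 0<ε = 0 , λ i _ → ℚ.+-mono-≤-< (/-mono-≤ 0 0 (root n i) i ℕ.z≤n) 0<ε

private
  module _ (n k r : ℕ)
           (lower : r ℕ.* r ℕ.≤ n ℕ.* (suc k ℕ.* suc k))
           (upper : n ℕ.* (suc k ℕ.* suc k) ℕ.< suc r ℕ.* suc r) where

    K′ c : ℕ
    K′ = suc k
    c  = suc (2 ℕ.* n)

    r≤nK : r ℕ.≤ n ℕ.* K′
    r≤nK = sq-cancel-≤ r (n ℕ.* K′) (ℕ.≤-trans lower (le n))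
      where
      assoc : ∀ n k → n ℕ.* (n ℕ.* (k ℕ.* k)) ≡ (n ℕ.* k) ℕ.* (n ℕ.* k)
      assoc = ℕSolver.solve-∀
      le : ∀ n → n ℕ.* (K′ ℕ.* K′) ℕ.≤ (n ℕ.* K′) ℕ.* (n ℕ.* K′)
      le zero = ℕ.z≤n
      le (suc n) = ℕ.≤-trans (ℕ.m≤n*m (suc n ℕ.* (K′ ℕ.* K′)) (suc n))
                             (ℕ.≤-reflexive (assoc (suc n) K′))

    nK²≤r²+cK : n ℕ.* (K′ ℕ.* K′) ℕ.≤ r ℕ.* r ℕ.+ c ℕ.* K′
    nK²≤r²+cK = ℕ.≤-trans (ℕ.<⇒≤ upper)
      (ℕ.≤-trans (ℕ.≤-reflexive (expand r))
      (ℕ.≤-trans (ℕ.+-monoʳ-≤ (r ℕ.* r) (ℕ.+-mono-≤ (ℕ.s≤s (ℕ.z≤n {k})) (ℕ.*-monoʳ-≤ 2 r≤nK)))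
                 (ℕ.≤-reflexive (collect (r ℕ.* r) n K′))))
      where
      expand : ∀ r → suc r ℕ.* suc r ≡ r ℕ.* r ℕ.+ (1 ℕ.+ 2 ℕ.* r)
      expand = ℕSolver.solve-∀
      collect : ∀ s n k → s ℕ.+ (k ℕ.+ 2 ℕ.* (n ℕ.* k)) ≡ s ℕ.+ (1 ℕ.+ 2 ℕ.* n) ℕ.* k
      collect = ℕSolver.solve-∀

    below : (+ r ℚ./ K′) ℚ.* (+ r ℚ./ K′) ℚ.≤ + n ℚ./ 1
    below = subst (ℚ._≤ + n ℚ./ 1) (sym (/-* r k r k))
      (/-mono-≤ (r ℕ.* r) (k ℕ.+ k ℕ.* K′) n 0
        (ℕ.≤-trans (ℕ.≤-reflexive (ℕ.*-identityʳ (r ℕ.* r))) lower))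

    above : + n ℚ./ 1 ℚ.≤ (+ r ℚ./ K′) ℚ.* (+ r ℚ./ K′) ℚ.+ (+ c ℚ./ K′)
    above = subst (+ n ℚ./ 1 ℚ.≤_)
      (trans (sym (/-+ (r ℕ.* r) (k ℕ.+ k ℕ.* K′) c k))
             (cong (ℚ._+ (+ c ℚ./ K′)) (sym (/-* r k r k))))
      (/-mono-≤ n 0 (r ℕ.* r ℕ.* K′ ℕ.+ c ℕ.* (K′ ℕ.* K′)) (k ℕ.+ (k ℕ.+ k ℕ.* K′) ℕ.* K′)
        (ℕ.≤-trans (ℕ.≤-reflexive (sym (ℕ.*-assoc n (K′ ℕ.* K′) K′)))
        (ℕ.≤-trans (ℕ.*-monoˡ-≤ K′ nK²≤r²+cK)
                   (ℕ.≤-reflexive (distrib (r ℕ.* r) c K′)))))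
      where
      distrib : ∀ s c k → (s ℕ.+ c ℕ.* k) ℕ.* k ≡ (s ℕ.* k ℕ.+ c ℕ.* (k ℕ.* k)) ℕ.* 1
      distrib = ℕSolver.solve-∀

    square-close : ∀ {δ ε} → 0ℚ ℚ.< ε → (+ c ℚ./ 1) ℚ.* δ ≡ ε → + 1 ℚ./ K′ ℚ.< δ →
                   ℚ.∣ (+ r ℚ./ K′) ℚ.* (+ r ℚ./ K′) ℚ.- (+ n ℚ./ 1) ∣ ℚ.< ε
    square-close {δ} {ε} 0<ε eq 1/K<δ = ∣-∣-<
      (ℚ.≤-<-trans below (subst (ℚ._< (+ n ℚ./ 1) ℚ.+ ε) (ℚ.+-identityʳ (+ n ℚ./ 1))
        (ℚ.+-monoʳ-< (+ n ℚ./ 1) 0<ε)))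
      (ℚ.≤-<-trans above (ℚ.+-monoʳ-< ((+ r ℚ./ K′) ℚ.* (+ r ℚ./ K′)) c/K<ε))
      where
      c/K≡ : (+ c ℚ./ 1) ℚ.* (+ 1 ℚ./ K′) ≡ + c ℚ./ K′
      c/K≡ = trans (/-* c 0 1 k)
        (ℚ./-cong (cong (λ z → + z) (ℕ.*-identityʳ c)) (ℕ.*-identityˡ K′))
      c/K<ε : + c ℚ./ K′ ℚ.< ε
      c/K<ε = subst₂ ℚ._<_ c/K≡ eq (ℚ.*-monoʳ-<-pos (+ c ℚ./ 1)
        {{ℚ.positive (/-mono-< 0 0 c 0 (ℕ.s≤s ℕ.z≤n))}} 1/K<δ)

√-square : ∀ n → √ n *ℝ √ n ≃ℝ fromℕ n
√-square n ε 0<ε =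
  let δ , 0<δ , eq = divide 0<ε (/-mono-< 0 0 (suc (2 ℕ.* n)) 0 (ℕ.s≤s ℕ.z≤n))
      N , h = archimedes δ 0<δ
  in N , λ k p → square-close n k (root n k)
       (isqrt-lower (n ℕ.* (suc k ℕ.* suc k))) (isqrt-upper (n ℕ.* (suc k ℕ.* suc k))) 0<ε eq (h k p)

{-# OPTIONS --safe #-}
-- With T = tp, it suffices to split {1, …, T(m+n)} into T sets of size m and T
-- sets of size n, all with the same sum: the sets are indexed by a copy of
-- K_{m,n} and a vertex of G, and regularity of G does the rest.
--
-- Cut the numbers into m + n runs of length T, each run giving one element to
-- every set of its side.  Let the m-side own some of the lowest runs, some of the
-- highest runs, and one more run sliding freely through the numbers in between,
-- which form the n-side.  As that run slides, the total of the m-side takes every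
-- multiple of T, up to a constant, between its extreme values, and condition (ii)
-- says precisely that half of the grand total does not exceed the maximum.
--
-- A pair of runs, one increasing and one decreasing, gives all the sets the same
-- sum.  This settles the m-side, and the n-side except for the run that the
-- sliding run cuts in two, at e and f with e + f = T.  There, sums differing by T
-- between the two pieces are compensated by a third run rotated by e.

module Submission where

open import Algebra.Properties.Semiring.Sum using ()
open import Data.Bool using (Bool; true; false; _∧_; if_then_else_)
open import Data.Fin using (Fin; zero; suc; toℕ; cast; splitAt; join; _↑ˡ_; _↑ʳ_; combine; remQuot; opposite)
open import Data.Fin.Patterns using (0F; 1F)
open import Data.Fin.Permutation using (Permutation′; _⟨$⟩ʳ_; _∘ₚ_; cast-id; reverse) renaming (id to idₚ)
open import Data.Fin.Properties using (toℕ-↑ˡ; toℕ-↑ʳ; toℕ-combine; toℕ-cast; toℕ<n; opposite-prop; splitAt-↑ˡ; splitAt-↑ʳ; splitAt⁻¹-↑ˡ; splitAt⁻¹-↑ʳ; remQuot-combine; +↔⊎; *↔×; _≟_)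
open import Data.Integer using (+_) renaming (_-_ to _-ℤ_)
import Data.Integer as ℤ
import Data.Integer.Properties as ℤ
open import Data.List using ([]; _∷_; map; filter; length; tabulate; allFin)
open import Data.List.Properties using (map-tabulate)
open import Data.Nat using (ℕ; zero; suc; _+_; _*_; _^_; _/_; _%_; _⊔_; _≤_; _<_; s≤s; z≤n; _≤?_; NonZero; >-nonZero⁻¹)
open import Data.Nat.DivMod using (m≡m%n+[m/n]*n; m%n<n; m<n*o⇒m/o<n)
open import Data.Nat.Divisibility using (_∣_; divides; m%n≡0⇒n∣m)
import Data.Nat.ListAction as List
open import Data.Nat.Properties using (m*n≢0)
import Data.Nat.Properties as ℕ
open import Data.Nat.Tactic.RingSolver using (solve-∀)
open import Data.Product using (Σ; ∃-syntax; _×_; _,_; proj₁; proj₂)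
open import Data.Product.Function.NonDependent.Propositional using (_×-↔_)
open import Data.Rational using (ℚ)
import Data.Rational as ℚ
import Data.Rational.Properties as ℚ
import Data.Rational.Solver as ℚSolver
open import Data.Sum using (_⊎_; inj₁; inj₂; swap)
open import Data.Sum.Algebra using (⊎-comm)
open import Data.Sum.Function.Propositional using (_⊎-↔_)
open import Function using (_∘_; _↔_; mk↔ₛ′)
open import Function.Bundles using (Inverse)
open import Function.Properties.Inverse using (↔-sym; ↔-trans; ↔-refl; ↔⇒⤖)
open import Relation.Binary.PropositionalEquality using (_≡_; refl; sym; trans; cong; cong₂; subst; subst₂)
open import Relation.Nullary using (does; yes; no; contradiction)
open import Relation.Unary using (Decidable)
open import Defs

open Algebra.Properties.Semiring.Sum ℕ.+-*-semiring using (sum; sum-cong-≗; sum-replicate-zero; ∑-distrib-+; *-distribˡ-sum)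
open ApproxLemmas
open Graph
open ℕ.≤-Reasoning

-- Sums over finite index sets

sum-+ : ∀ m {n} (f : Fin (m + n) → ℕ) →
        sum f ≡ sum (λ i → f (i ↑ˡ n)) + sum (λ i → f (m ↑ʳ i))
sum-+ zero    f = refl
sum-+ (suc m) f = trans (cong (_+_ (f zero)) (sum-+ m (f ∘ suc))) (sym (ℕ.+-assoc (f zero) _ _))

-- Labels have the form `T` times a position plus an offset; this separates the contribution of the
-- positions from that of the offsets.
sum-affine : ∀ {n} c (f g : Fin n → ℕ) →
             sum (λ i → suc (c * f i + g i)) ≡ c * sum f + sum (λ i → suc (g i))
sum-affine c f g = begin-equality
  sum (λ i → suc (c * f i + g i))            ≡⟨ sum-cong-≗ (λ i → ℕ.+-suc (c * f i) (g i)) ⟨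
  sum (λ i → c * f i + suc (g i))            ≡⟨ ∑-distrib-+ (λ i → c * f i) (λ i → suc (g i)) ⟩
  sum (λ i → c * f i) + sum (λ i → suc (g i)) ≡⟨ cong (_+ sum (λ i → suc (g i))) (*-distribˡ-sum c f) ⟨
  c * sum f + sum (λ i → suc (g i))          ∎

-- An arithmetic progression, doubled and with `n` moved to the left to avoid halving and
-- subtraction.
sum-toℕ-shift : ∀ c n → 2 * sum {n} (λ i → c + toℕ i) + n ≡ 2 * (n * c) + n * n
sum-toℕ-shift c zero    = refl
sum-toℕ-shift c (suc n) = begin-equality
  2 * (c + 0 + S) + suc n                  ≡⟨ expand c S n ⟩
  suc (2 * c) + (2 * S + n)                ≡⟨ cong (λ s → suc (2 * c) + (2 * s + n)) (sum-cong-≗ {n} (λ i → ℕ.+-suc c (toℕ i))) ⟩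
  suc (2 * c) + (2 * sum {n} (λ i → suc c + toℕ i) + n) ≡⟨ cong (_+_ (suc (2 * c))) (sum-toℕ-shift (suc c) n) ⟩
  suc (2 * c) + (2 * (n * suc c) + n * n)  ≡⟨ collect c n ⟩
  2 * (suc n * c) + suc n * suc n          ∎
  where
  S = sum {n} (λ i → c + suc (toℕ i))
  expand : ∀ c S n → 2 * (c + 0 + S) + suc n ≡ suc (2 * c) + (2 * S + n)
  expand = solve-∀
  collect : ∀ c n → suc (2 * c) + (2 * (n * suc c) + n * n) ≡ 2 * (suc n * c) + suc n * suc n
  collect = solve-∀

opposite-sum : ∀ {n} (i : Fin n) → suc (toℕ i) + toℕ (opposite i) ≡ n
opposite-sum {n} i = trans (cong (_+_ (suc (toℕ i))) (opposite-prop i)) (ℕ.m+[n∸m]≡n (toℕ<n i))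

-- Equal-sum splits and alternating runs

-- A row `r` stands for one set of size `m` and one of size `n`, the columns for the elements within
-- a set. Both sides share `c`, since the vertices on either side of `K m n` see the other one.
EqualSumSplit : ℕ → ℕ → ℕ → Set
EqualSumSplit T m n =
  Σ (((Fin m ⊎ Fin n) × Fin T) ↔ Fin ((m + n) * T)) λ φ →
    ∃[ c ] (∀ r → sum (λ i → suc (toℕ (Inverse.to φ (inj₁ i , r)))) ≡ c)
         × (∀ r → sum (λ i → suc (toℕ (Inverse.to φ (inj₂ i , r)))) ≡ c)

module _ {T : ℕ} where

  alternate : ∀ {n} → Fin n → Permutation′ T
  alternate zero          = idₚ
  alternate (suc zero)    = reverse
  alternate (suc (suc i)) = alternate i

  -- Consecutive columns form pairs contributing `r + 1` and `T - r`, hence `T + 1` in every row.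
  sum-alternate : ∀ a {n} → n ≡ a * 2 → (r : Fin T) →
                  sum {n} (λ i → suc (toℕ (alternate i ⟨$⟩ʳ r))) ≡ a * suc T
  sum-alternate zero    refl r = refl
  sum-alternate (suc a) refl r = begin-equality
    suc (toℕ r) + (suc (toℕ (opposite r)) + S) ≡⟨ regroup (toℕ r) (toℕ (opposite r)) S ⟩
    suc (suc (toℕ r) + toℕ (opposite r)) + S   ≡⟨ cong₂ (λ x y → suc x + y) (opposite-sum r) (sum-alternate a refl r) ⟩
    suc T + a * suc T                          ∎
    where
    S = sum {a * 2} (λ i → suc (toℕ (alternate i ⟨$⟩ʳ r)))
    regroup : ∀ r o S → suc r + (suc o + S) ≡ suc (suc r + o) + S
    regroup = solve-∀

-- Labelling the columns by runs

fibrewise : ∀ {A B : Set} → (A → B ↔ B) → (A × B) ↔ (A × B)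
fibrewise π = mk↔ₛ′
  (λ (a , b) → a , Inverse.to (π a) b)
  (λ (a , b) → a , Inverse.from (π a) b)
  (λ (a , b) → cong (a ,_) (Inverse.strictlyInverseˡ (π a) b))
  (λ (a , b) → cong (a ,_) (Inverse.strictlyInverseʳ (π a) b))

-- To label row r of column c: permute the rows of column c to get an offset o,
-- exchange the first columns of the two sides when o ≥ e, and fill the columns with
-- runs of T = e + f consecutive numbers in the order given by pos.  When the first
-- run of the m-side directly follows that of the n-side, the exchange slides it
-- down by f.
module Labelling (e f A B : ℕ)
                 (pos : (Fin (suc A) ⊎ Fin (suc B)) ↔ Fin (suc A + suc B)) where

  T : ℕ
  T = e + f

  Column : Set
  Column = Fin (suc A) ⊎ Fin (suc B)

  position : Column → ℕ
  position c = toℕ (Inverse.to pos c)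

  -- The cyclic shift by `e` modulo `T`: it sends `r` to `e + r` for `r < f` and to `r - f`
  -- otherwise.
  rotate : Permutation′ T
  rotate = ↔-trans (cast-id (ℕ.+-comm e f)) (↔-trans +↔⊎ (↔-trans (⊎-comm (Fin f) (Fin e)) (↔-sym +↔⊎)))

  exchange : Column → Fin e ⊎ Fin f → Column
  exchange (inj₁ (suc i)) _        = inj₁ (suc i)
  exchange (inj₂ (suc i)) _        = inj₂ (suc i)
  exchange (inj₁ zero)    (inj₁ _) = inj₁ zero
  exchange (inj₁ zero)    (inj₂ _) = inj₂ zero
  exchange (inj₂ zero)    (inj₁ _) = inj₂ zero
  exchange (inj₂ zero)    (inj₂ _) = inj₁ zero

  exchange-involutive : ∀ c s → exchange (exchange c s) s ≡ c
  exchange-involutive (inj₁ (suc i)) _        = refl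
  exchange-involutive (inj₂ (suc i)) _        = refl
  exchange-involutive (inj₁ zero)    (inj₁ _) = refl
  exchange-involutive (inj₁ zero)    (inj₂ _) = refl
  exchange-involutive (inj₂ zero)    (inj₁ _) = refl
  exchange-involutive (inj₂ zero)    (inj₂ _) = refl

  exchange↔ : (Column × Fin T) ↔ (Column × Fin T)
  exchange↔ = mk↔ₛ′ to to involutive involutive
    where
    to : Column × Fin T → Column × Fin T
    to (c , o) = exchange c (splitAt e o) , o
    involutive : ∀ x → to (to x) ≡ x
    involutive (c , o) = cong (_, o) (exchange-involutive c (splitAt e o))

  -- With `o` the rotated offset of row `r`, the exchanged first column varies like `2 * o - r`.
  -- Columns 1 and 3 contribute `- o` each and column 2 contributes `r`, which balances the first
  -- four columns; the others pair up.
  rows-n : ∀ {n} → Fin n → Permutation′ T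
  rows-n zero                      = rotate
  rows-n (suc zero)                = rotate ∘ₚ reverse
  rows-n (suc (suc zero))          = idₚ
  rows-n (suc (suc (suc zero)))    = rotate ∘ₚ reverse
  rows-n (suc (suc (suc (suc i)))) = alternate i

  -- When the two first runs are adjacent, the exchange makes the rotated first column of the m-side
  -- increasing in `r`, so it takes the place of `alternate zero`.
  rows : Column → Permutation′ T
  rows (inj₁ zero)    = rotate
  rows (inj₁ (suc i)) = alternate (suc i)
  rows (inj₂ i)       = rows-n i

  labelling : (Column × Fin T) ↔ Fin ((suc A + suc B) * T)
  labelling = ↔-trans (fibrewise rows) (↔-trans exchange↔ (↔-trans (pos ×-↔ ↔-refl) (↔-sym *↔×)))

  offset : Column → Fin T → ℕ
  offset c r = toℕ (rows c ⟨$⟩ʳ r)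

  label : Column → Fin T → ℕ
  label c r = toℕ (Inverse.to labelling (c , r))

  label-value : ∀ c r → label c r ≡ T * position (exchange c (splitAt e (rows c ⟨$⟩ʳ r))) + offset c r
  label-value c r = toℕ-combine (Inverse.to pos (exchange c (splitAt e (rows c ⟨$⟩ʳ r)))) (rows c ⟨$⟩ʳ r)

  -- `low` and `high` refer to the row, not to its offset: the rows below `f` receive offsets from
  -- `e` on, and in a rotated first column exactly these are exchanged.
  data Rotated (r : Fin T) : Set where
    low  : (i : Fin f) → toℕ r ≡ toℕ i → rotate ⟨$⟩ʳ r ≡ e ↑ʳ i → Rotated r
    high : (i : Fin e) → toℕ r ≡ f + toℕ i → rotate ⟨$⟩ʳ r ≡ i ↑ˡ f → Rotated r

  rotated : ∀ r → Rotated r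
  rotated r with splitAt f (cast (ℕ.+-comm e f) r) in eq
  ... | inj₁ i = low i
          (trans (sym (toℕ-cast (ℕ.+-comm e f) r)) (trans (cong toℕ (sym (splitAt⁻¹-↑ˡ eq))) (toℕ-↑ˡ i e)))
          (cong (join e f ∘ swap) eq)
  ... | inj₂ i = high i
          (trans (sym (toℕ-cast (ℕ.+-comm e f) r)) (trans (cong toℕ (sym (splitAt⁻¹-↑ʳ {f} eq))) (toℕ-↑ʳ f i)))
          (cong (join e f ∘ swap) eq)

  -- A shift by `e = T` is trivial modulo `T`.
  rotate-full : f ≡ 0 → ∀ r → toℕ (rotate ⟨$⟩ʳ r) ≡ toℕ r
  rotate-full f≡0 r with rotated r
  ... | low i _ _ with () ← subst Fin f≡0 i
  ... | high i r≡ o≡ = begin-equality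
    toℕ (rotate ⟨$⟩ʳ r) ≡⟨ cong toℕ o≡ ⟩
    toℕ (i ↑ˡ f)        ≡⟨ toℕ-↑ˡ i f ⟩
    toℕ i               ≡⟨ cong (_+ toℕ i) f≡0 ⟨
    f + toℕ i           ≡⟨ r≡ ⟨
    toℕ r               ∎

  -- Up to shifts by one, the first column gives `c + 2 * o - r` and the next three give
  -- `2 * o′ + r`, where `o + o′` is constant. For `b ≡ 1` there are too few columns for this, but
  -- then `f ≡ 0` gives `o = r`, and one reversed run suffices.
  sum-rows-n : ∀ b {n} → suc n ≡ b * 2 → 2 ≤ b ⊎ (b ≡ 1 × f ≡ 0) → ∀ r {x c} →
               x + toℕ r ≡ c + 2 * toℕ (rotate ⟨$⟩ʳ r) →
               suc x + sum {n} (λ i → suc (toℕ (rows-n (suc i) ⟨$⟩ʳ r))) ≡ c + b * suc T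
  sum-rows-n (suc (suc b)) refl (inj₁ _) r {x} {c} eq = begin-equality
    suc x + (suc o′ + (suc (toℕ r) + (suc o′ + S))) ≡⟨ regroup₁ x o′ (toℕ r) S ⟩
    (x + toℕ r) + (2 * suc (suc o′) + S)           ≡⟨ cong₂ (λ y z → y + (2 * suc (suc o′) + z)) eq (sum-alternate b refl r) ⟩
    (c + 2 * o) + (2 * suc (suc o′) + b * suc T)   ≡⟨ regroup₂ c o o′ (b * suc T) ⟩
    c + (2 * suc (suc o + o′) + b * suc T)         ≡⟨ cong (λ y → c + (2 * suc y + b * suc T)) (opposite-sum (rotate ⟨$⟩ʳ r)) ⟩
    c + (2 * suc T + b * suc T)                    ≡⟨ cong (_+_ c) (regroup₃ b T) ⟩
    c + suc (suc b) * suc T                        ∎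
    where
    o = toℕ (rotate ⟨$⟩ʳ r)
    o′ = toℕ (opposite (rotate ⟨$⟩ʳ r))
    S = sum {b * 2} (λ i → suc (toℕ (alternate i ⟨$⟩ʳ r)))
    regroup₁ : ∀ x o r S → suc x + (suc o + (suc r + (suc o + S))) ≡ (x + r) + (2 * suc (suc o) + S)
    regroup₁ = solve-∀
    regroup₂ : ∀ c o o′ y → (c + 2 * o) + (2 * suc (suc o′) + y) ≡ c + (2 * suc (suc o + o′) + y)
    regroup₂ = solve-∀
    regroup₃ : ∀ b T → 2 * suc T + b * suc T ≡ suc (suc b) * suc T
    regroup₃ = solve-∀
  sum-rows-n (suc zero) refl (inj₁ (s≤s ()))
  sum-rows-n (suc zero) refl (inj₂ (_ , f≡0)) r {x} {c} eq = begin-equality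
    suc x + (suc o′ + 0)     ≡⟨ cong (λ y → suc y + (suc o′ + 0)) x≡ ⟩
    suc (c + o) + (suc o′ + 0) ≡⟨ regroup c o o′ ⟩
    c + suc (suc o + o′)     ≡⟨ cong (λ y → c + suc y) (opposite-sum (rotate ⟨$⟩ʳ r)) ⟩
    c + suc T                ≡⟨ cong (_+_ c) (ℕ.*-identityˡ (suc T)) ⟨
    c + 1 * suc T            ∎
    where
    o = toℕ (rotate ⟨$⟩ʳ r)
    o′ = toℕ (opposite (rotate ⟨$⟩ʳ r))
    x≡ : x ≡ c + o
    x≡ = ℕ.+-cancelʳ-≡ o x (c + o) (begin-equality
      x + o       ≡⟨ cong (_+_ x) (rotate-full f≡0 r) ⟩
      x + toℕ r   ≡⟨ eq ⟩
      c + 2 * o   ≡⟨ double c o ⟩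
      c + o + o   ∎)
      where
      double : ∀ c o → c + 2 * o ≡ c + o + o
      double = solve-∀
    regroup : ∀ c o o′ → suc (c + o) + (suc o′ + 0) ≡ c + suc (suc o + o′)
    regroup = solve-∀

  module Sums (u : ℕ) (n₀ : position (inj₂ zero) ≡ u) (m₀ : position (inj₁ zero) ≡ suc u) where

    -- Rows below `f` fill the end of run `u` from offset `e` on, the other rows the first `e`
    -- places of run `suc u`. Together they form the sliding run.
    first-m : ∀ r → label (inj₁ zero) r ≡ T * u + e + toℕ r
    first-m r with rotated r
    ... | low i r≡ o≡ = begin-equality
      label (inj₁ zero) r
        ≡⟨ label-value (inj₁ zero) r ⟩
      T * position (exchange (inj₁ zero) (splitAt e (rotate ⟨$⟩ʳ r))) + toℕ (rotate ⟨$⟩ʳ r)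
        ≡⟨ cong (λ o → T * position (exchange (inj₁ zero) (splitAt e o)) + toℕ o) o≡ ⟩
      T * position (exchange (inj₁ zero) (splitAt e (e ↑ʳ i))) + toℕ (e ↑ʳ i)
        ≡⟨ cong₂ (λ s o → T * position (exchange (inj₁ zero) s) + o) (splitAt-↑ʳ e f i) (toℕ-↑ʳ e i) ⟩
      T * position (inj₂ zero) + (e + toℕ i)
        ≡⟨ cong₂ (λ p x → T * p + (e + x)) n₀ (sym r≡) ⟩
      T * u + (e + toℕ r)
        ≡⟨ ℕ.+-assoc (T * u) e (toℕ r) ⟨
      T * u + e + toℕ r ∎
    ... | high i r≡ o≡ = begin-equality
      label (inj₁ zero) r
        ≡⟨ label-value (inj₁ zero) r ⟩
      T * position (exchange (inj₁ zero) (splitAt e (rotate ⟨$⟩ʳ r))) + toℕ (rotate ⟨$⟩ʳ r)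
        ≡⟨ cong (λ o → T * position (exchange (inj₁ zero) (splitAt e o)) + toℕ o) o≡ ⟩
      T * position (exchange (inj₁ zero) (splitAt e (i ↑ˡ f))) + toℕ (i ↑ˡ f)
        ≡⟨ cong₂ (λ s o → T * position (exchange (inj₁ zero) s) + o) (splitAt-↑ˡ e i f) (toℕ-↑ˡ i f) ⟩
      T * position (inj₁ zero) + toℕ i
        ≡⟨ cong (λ p → T * p + toℕ i) m₀ ⟩
      T * suc u + toℕ i
        ≡⟨ regroup e f u (toℕ i) ⟩
      T * u + e + (f + toℕ i)
        ≡⟨ cong (_+_ (T * u + e)) r≡ ⟨
      T * u + e + toℕ r ∎
      where
      regroup : ∀ e f u i → (e + f) * suc u + i ≡ (e + f) * u + e + (f + i)
      regroup = solve-∀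

    -- Up to offsets, the label is T * u + f - r: the decreasing r is what two reversed
    -- rotated runs and one increasing run cancel in sum-rows-n.
    first-n : ∀ r → label (inj₂ zero) r + toℕ r ≡ T * u + f + 2 * offset (inj₂ zero) r
    first-n r with rotated r
    ... | low i r≡ o≡ = begin-equality
      label (inj₂ zero) r + toℕ r
        ≡⟨ cong₂ _+_ (label-value (inj₂ zero) r) r≡ ⟩
      T * position (exchange (inj₂ zero) (splitAt e (rotate ⟨$⟩ʳ r))) + toℕ (rotate ⟨$⟩ʳ r) + toℕ i
        ≡⟨ cong (λ o → T * position (exchange (inj₂ zero) (splitAt e o)) + toℕ o + toℕ i) o≡ ⟩
      T * position (exchange (inj₂ zero) (splitAt e (e ↑ʳ i))) + toℕ (e ↑ʳ i) + toℕ i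
        ≡⟨ cong₂ (λ s o → T * position (exchange (inj₂ zero) s) + o + toℕ i) (splitAt-↑ʳ e f i) (toℕ-↑ʳ e i) ⟩
      T * position (inj₁ zero) + (e + toℕ i) + toℕ i
        ≡⟨ cong (λ p → T * p + (e + toℕ i) + toℕ i) m₀ ⟩
      T * suc u + (e + toℕ i) + toℕ i
        ≡⟨ regroup e f u (toℕ i) ⟩
      T * u + f + 2 * (e + toℕ i)
        ≡⟨ cong (λ o → T * u + f + 2 * o) (trans (sym (toℕ-↑ʳ e i)) (cong toℕ (sym o≡))) ⟩
      T * u + f + 2 * offset (inj₂ zero) r ∎
      where
      regroup : ∀ e f u i → (e + f) * suc u + (e + i) + i ≡ (e + f) * u + f + 2 * (e + i)
      regroup = solve-∀
    ... | high i r≡ o≡ = begin-equality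
      label (inj₂ zero) r + toℕ r
        ≡⟨ cong₂ _+_ (label-value (inj₂ zero) r) r≡ ⟩
      T * position (exchange (inj₂ zero) (splitAt e (rotate ⟨$⟩ʳ r))) + toℕ (rotate ⟨$⟩ʳ r) + (f + toℕ i)
        ≡⟨ cong (λ o → T * position (exchange (inj₂ zero) (splitAt e o)) + toℕ o + (f + toℕ i)) o≡ ⟩
      T * position (exchange (inj₂ zero) (splitAt e (i ↑ˡ f))) + toℕ (i ↑ˡ f) + (f + toℕ i)
        ≡⟨ cong₂ (λ s o → T * position (exchange (inj₂ zero) s) + o + (f + toℕ i)) (splitAt-↑ˡ e i f) (toℕ-↑ˡ i f) ⟩
      T * position (inj₂ zero) + toℕ i + (f + toℕ i)
        ≡⟨ cong (λ p → T * p + toℕ i + (f + toℕ i)) n₀ ⟩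
      T * u + toℕ i + (f + toℕ i)
        ≡⟨ regroup (T * u) f (toℕ i) ⟩
      T * u + f + 2 * toℕ i
        ≡⟨ cong (λ o → T * u + f + 2 * o) (trans (sym (toℕ-↑ˡ i f)) (cong toℕ (sym o≡))) ⟩
      T * u + f + 2 * offset (inj₂ zero) r ∎
      where
      regroup : ∀ c f i → c + i + (f + i) ≡ c + f + 2 * i
      regroup = solve-∀

    sum-m : ∀ a → suc A ≡ a * 2 → ∀ r →
            sum (λ i → suc (label (inj₁ i) r)) ≡ T * (u + sum (position ∘ inj₁ ∘ suc)) + e + a * suc T
    sum-m a A≡ r = begin-equality
      suc (label (inj₁ zero) r) + sum (λ i → suc (label (inj₁ (suc i)) r))
        ≡⟨ cong₂ (λ x y → suc x + y) (first-m r)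
             (trans (sum-cong-≗ (λ i → cong suc (label-value (inj₁ (suc i)) r)))
                    (sum-affine T (position ∘ inj₁ ∘ suc) (λ i → offset (inj₁ (suc i)) r))) ⟩
      suc (T * u + e + toℕ r) + (T * P + S)
        ≡⟨ regroup T u e (toℕ r) P S ⟩
      -- The sliding run counts as position `u` plus `e`; its `suc (toℕ r)` completes the
      -- alternating columns.
      T * (u + P) + e + (suc (toℕ r) + S)
        ≡⟨ cong (_+_ (T * (u + P) + e)) (sum-alternate a A≡ r) ⟩
      T * (u + P) + e + a * suc T ∎
      where
      P = sum (position ∘ inj₁ ∘ suc)
      S = sum (λ i → suc (offset (inj₁ (suc i)) r))
      regroup : ∀ T u e r P S → suc (T * u + e + r) + (T * P + S) ≡ T * (u + P) + e + (suc r + S)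
      regroup = solve-∀

    sum-n : ∀ b → suc B ≡ b * 2 → 2 ≤ b ⊎ (b ≡ 1 × f ≡ 0) → ∀ r →
            sum (λ i → suc (label (inj₂ i) r)) ≡ T * (u + sum (position ∘ inj₂ ∘ suc)) + f + b * suc T
    sum-n b B≡ h r = begin-equality
      suc (label (inj₂ zero) r) + sum (λ i → suc (label (inj₂ (suc i)) r))
        ≡⟨ cong (_+_ (suc (label (inj₂ zero) r)))
             (trans (sum-cong-≗ (λ i → cong suc (label-value (inj₂ (suc i)) r)))
                    (sum-affine T (position ∘ inj₂ ∘ suc) (λ i → offset (inj₂ (suc i)) r))) ⟩
      suc (label (inj₂ zero) r) + (T * Q + S)
        ≡⟨ regroup₁ (label (inj₂ zero) r) (T * Q) S ⟩
      (suc (label (inj₂ zero) r) + S) + T * Q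
        ≡⟨ cong (_+ T * Q) (sum-rows-n b B≡ h r (first-n r)) ⟩
      (T * u + f + b * suc T) + T * Q
        ≡⟨ regroup₂ T u f (b * suc T) Q ⟩
      T * (u + Q) + f + b * suc T ∎
      where
      Q = sum (position ∘ inj₂ ∘ suc)
      S = sum (λ i → suc (offset (inj₂ (suc i)) r))
      regroup₁ : ∀ l q s → suc l + (q + s) ≡ (suc l + s) + q
      regroup₁ = solve-∀
      regroup₂ : ∀ T u f x Q → (T * u + f + x) + T * Q ≡ T * (u + Q) + f + x
      regroup₂ = solve-∀

-- Positions of the runs

-- In increasing order: k runs of the m-side, y runs of the n-side, the first run of
-- the n-side, the first run of the m-side, z runs of the n-side, j runs of the m-side.
module Layout (k j y z : ℕ) where

  Column : Set
  Column = Fin (suc (k + j)) ⊎ Fin (suc (y + z))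

  Blocks : Set
  Blocks = Fin k ⊎ (Fin y ⊎ (Fin 2 ⊎ (Fin z ⊎ Fin j)))

  block-m : Fin k ⊎ Fin j → Blocks
  block-m (inj₁ i) = inj₁ i
  block-m (inj₂ i) = inj₂ (inj₂ (inj₂ (inj₂ i)))

  block-n : Fin y ⊎ Fin z → Blocks
  block-n (inj₁ i) = inj₂ (inj₁ i)
  block-n (inj₂ i) = inj₂ (inj₂ (inj₂ (inj₁ i)))

  block : Column → Blocks
  block (inj₁ zero)    = inj₂ (inj₂ (inj₁ 1F))
  block (inj₁ (suc i)) = block-m (splitAt k i)
  block (inj₂ zero)    = inj₂ (inj₂ (inj₁ 0F))
  block (inj₂ (suc i)) = block-n (splitAt y i)

  unblock : Blocks → Column
  unblock (inj₁ i)                      = inj₁ (suc (i ↑ˡ j))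
  unblock (inj₂ (inj₁ i))               = inj₂ (suc (i ↑ˡ z))
  unblock (inj₂ (inj₂ (inj₁ 0F)))       = inj₂ zero
  unblock (inj₂ (inj₂ (inj₁ 1F)))       = inj₁ zero
  unblock (inj₂ (inj₂ (inj₂ (inj₁ i)))) = inj₂ (suc (y ↑ʳ i))
  unblock (inj₂ (inj₂ (inj₂ (inj₂ i)))) = inj₁ (suc (k ↑ʳ i))

  block-unblock : ∀ b → block (unblock b) ≡ b
  block-unblock (inj₁ i)                      = cong block-m (splitAt-↑ˡ k i j)
  block-unblock (inj₂ (inj₁ i))               = cong block-n (splitAt-↑ˡ y i z)
  block-unblock (inj₂ (inj₂ (inj₁ 0F)))       = refl
  block-unblock (inj₂ (inj₂ (inj₁ 1F)))       = refl
  block-unblock (inj₂ (inj₂ (inj₂ (inj₁ i)))) = cong block-n (splitAt-↑ʳ y z i)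
  block-unblock (inj₂ (inj₂ (inj₂ (inj₂ i)))) = cong block-m (splitAt-↑ʳ k j i)

  unblock-block : ∀ c → unblock (block c) ≡ c
  unblock-block (inj₁ zero) = refl
  unblock-block (inj₂ zero) = refl
  unblock-block (inj₁ (suc i)) with splitAt k i in eq
  ... | inj₁ _ = cong (inj₁ ∘ suc) (splitAt⁻¹-↑ˡ eq)
  ... | inj₂ _ = cong (inj₁ ∘ suc) (splitAt⁻¹-↑ʳ {k} eq)
  unblock-block (inj₂ (suc i)) with splitAt y i in eq
  ... | inj₁ _ = cong (inj₂ ∘ suc) (splitAt⁻¹-↑ˡ eq)
  ... | inj₂ _ = cong (inj₂ ∘ suc) (splitAt⁻¹-↑ʳ {y} eq)

  size : k + (y + (2 + (z + j))) ≡ suc (k + j) + suc (y + z)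
  size = lemma k j y z
    where
    lemma : ∀ k j y z → k + (y + (2 + (z + j))) ≡ suc (k + j) + suc (y + z)
    lemma = solve-∀

  place : Blocks ↔ Fin (k + (y + (2 + (z + j))))
  place = ↔-trans (↔-refl ⊎-↔ ↔-trans (↔-refl ⊎-↔ ↔-trans (↔-refl ⊎-↔ ↔-sym +↔⊎) (↔-sym +↔⊎)) (↔-sym +↔⊎)) (↔-sym +↔⊎)

  pos : Column ↔ Fin (suc (k + j) + suc (y + z))
  pos = ↔-trans (mk↔ₛ′ block unblock block-unblock unblock-block) (↔-trans place (cast-id size))

  position : Column → ℕ
  position c = toℕ (Inverse.to pos c)

  -- Columns written as `unblock b` need no analysis of `splitAt`, so the positions below are all
  -- computed in this form.
  position-unblock : ∀ b → position (unblock b) ≡ toℕ (Inverse.to place b)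
  position-unblock b = trans (toℕ-cast size (Inverse.to place (block (unblock b))))
                             (cong (toℕ ∘ Inverse.to place) (block-unblock b))

  position-n₀ : position (inj₂ zero) ≡ k + y
  position-n₀ = trans (position-unblock (inj₂ (inj₂ (inj₁ 0F))))
    (trans (toℕ-↑ʳ k _) (cong (_+_ k) (trans (toℕ-↑ʳ y _) (ℕ.+-identityʳ y))))

  position-m₀ : position (inj₁ zero) ≡ suc (k + y)
  position-m₀ = trans (position-unblock (inj₂ (inj₂ (inj₁ 1F))))
    (trans (toℕ-↑ʳ k _) (trans (cong (_+_ k) (trans (toℕ-↑ʳ y _) (ℕ.+-comm y 1))) (ℕ.+-suc k y)))

  sum-position-m : sum (position ∘ inj₁ ∘ suc)
                   ≡ sum {k} (λ i → 0 + toℕ i) + sum {j} (λ i → (k + y + 2 + z) + toℕ i)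
  sum-position-m = trans (sum-+ k (position ∘ inj₁ ∘ suc)) (cong₂ _+_
    (sum-cong-≗ λ i → trans (position-unblock (inj₁ i)) (toℕ-↑ˡ i _))
    (sum-cong-≗ λ i → begin-equality
      position (inj₁ (suc (k ↑ʳ i)))
        ≡⟨ position-unblock (inj₂ (inj₂ (inj₂ (inj₂ i)))) ⟩
      toℕ (k ↑ʳ (y ↑ʳ (2 ↑ʳ (z ↑ʳ i))))
        ≡⟨ trans (toℕ-↑ʳ k _) (cong (_+_ k) (trans (toℕ-↑ʳ y _) (cong (λ x → y + (2 + x)) (toℕ-↑ʳ z i)))) ⟩
      k + (y + (2 + (z + toℕ i)))
        ≡⟨ assoc k y z (toℕ i) ⟩
      (k + y + 2 + z) + toℕ i ∎))
    where
    assoc : ∀ k y z i → k + (y + (2 + (z + i))) ≡ (k + y + 2 + z) + i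
    assoc = solve-∀

  sum-position-n : sum (position ∘ inj₂ ∘ suc)
                   ≡ sum {y} (λ i → k + toℕ i) + sum {z} (λ i → (k + y + 2) + toℕ i)
  sum-position-n = trans (sum-+ y (position ∘ inj₂ ∘ suc)) (cong₂ _+_
    (sum-cong-≗ λ i → trans (position-unblock (inj₂ (inj₁ i)))
      (trans (toℕ-↑ʳ k _) (cong (_+_ k) (toℕ-↑ˡ i _))))
    (sum-cong-≗ λ i → begin-equality
      position (inj₂ (suc (y ↑ʳ i)))
        ≡⟨ position-unblock (inj₂ (inj₂ (inj₂ (inj₁ i)))) ⟩
      toℕ (k ↑ʳ (y ↑ʳ (2 ↑ʳ (i ↑ˡ j))))
        ≡⟨ trans (toℕ-↑ʳ k _) (cong (_+_ k) (trans (toℕ-↑ʳ y _) (cong (λ x → y + (2 + x)) (toℕ-↑ˡ i j)))) ⟩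
      k + (y + (2 + toℕ i))
        ≡⟨ assoc k y (toℕ i) ⟩
      (k + y + 2) + toℕ i ∎))
    where
    assoc : ∀ k y i → k + (y + (2 + i)) ≡ (k + y + 2) + i
    assoc = solve-∀

-- Sums of the two sides in a layout

-- The m-side has sum `a + 2 * (T * (a * a))` when it owns the lowest runs. From there each of the
-- `j` highest runs gains `T` for each of the `b * 2` runs that it passes, and the sliding run gains
-- `T * y + e`. So `excess` says that the m-side has half of the total of a row.
split-from-layout : ∀ {T} a b s k j y z e f →
                    T ≡ e + f → suc (k + j) ≡ a * 2 → suc (y + z) ≡ b * 2 →
                    2 ≤ b ⊎ (b ≡ 1 × f ≡ 0) → a + b ≡ 2 * s →
                    T * (j * (b * 2) + y) + e + (a + 2 * (T * (a * a))) ≡ s * (4 * (T * s) + 1) →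
                    EqualSumSplit T (a * 2) (b * 2)
split-from-layout a b s k j y z e f refl A≡ B≡ b-cond a+b≡2s excess =
  subst₂ (EqualSumSplit T) A≡ B≡ (labelling , X ,
    (λ r → trans (sum-m a A≡ r) M≡X) ,
    (λ r → trans (sum-n b B≡ b-cond r) N≡X))
  where
  module L = Layout k j y z
  open Labelling e f (k + j) (y + z) L.pos
  open Sums (k + y) L.position-n₀ L.position-m₀

  A B X P Q : ℕ
  A = suc (k + j)
  B = suc (y + z)
  X = s * (4 * (T * s) + 1)
  P = sum (position ∘ inj₁ ∘ suc)
  Q = sum (position ∘ inj₂ ∘ suc)

  -- The `A` lowest positions would add up to `A * (A - 1) / 2`. Each of the `j` highest runs has
  -- moved up by `B`, and the sliding run, counted at `k + y`, by `y`.
  2P≡ : 2 * (k + y + P) + A ≡ A * A + 2 * (j * B + y)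
  2P≡ = begin-equality
    2 * (k + y + P) + A
      ≡⟨ cong (λ p → 2 * (k + y + p) + A) L.sum-position-m ⟩
    2 * (k + y + (p₁ + p₂)) + A
      ≡⟨ regroup k y p₁ p₂ j ⟩
    2 * (k + y) + 1 + ((2 * p₁ + k) + (2 * p₂ + j))
      ≡⟨ cong₂ (λ v w → 2 * (k + y) + 1 + (v + w)) (sum-toℕ-shift 0 k) (sum-toℕ-shift (k + y + 2 + z) j) ⟩
    2 * (k + y) + 1 + ((2 * (k * 0) + k * k) + (2 * (j * (k + y + 2 + z)) + j * j))
      ≡⟨ collect k j y z ⟩
    A * A + 2 * (j * B + y) ∎
    where
    p₁ = sum {k} (λ i → 0 + toℕ i)
    p₂ = sum {j} (λ i → (k + y + 2 + z) + toℕ i)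
    regroup : ∀ k y p₁ p₂ j → 2 * (k + y + (p₁ + p₂)) + suc (k + j) ≡ 2 * (k + y) + 1 + ((2 * p₁ + k) + (2 * p₂ + j))
    regroup = solve-∀
    collect : ∀ k j y z → 2 * (k + y) + 1 + ((2 * (k * 0) + k * k) + (2 * (j * (k + y + 2 + z)) + j * j))
              ≡ suc (k + j) * suc (k + j) + 2 * (j * suc (y + z) + y)
    collect = solve-∀

  2Q≡ : 2 * (k + y + Q) + B ≡ B * B + 2 * (k * B + z)
  2Q≡ = begin-equality
    2 * (k + y + Q) + B
      ≡⟨ cong (λ q → 2 * (k + y + q) + B) L.sum-position-n ⟩
    2 * (k + y + (q₁ + q₂)) + B
      ≡⟨ regroup k y q₁ q₂ z ⟩
    2 * (k + y) + 1 + ((2 * q₁ + y) + (2 * q₂ + z))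
      ≡⟨ cong₂ (λ v w → 2 * (k + y) + 1 + (v + w)) (sum-toℕ-shift k y) (sum-toℕ-shift (k + y + 2) z) ⟩
    2 * (k + y) + 1 + ((2 * (y * k) + y * y) + (2 * (z * (k + y + 2)) + z * z))
      ≡⟨ collect k y z ⟩
    B * B + 2 * (k * B + z) ∎
    where
    q₁ = sum {y} (λ i → k + toℕ i)
    q₂ = sum {z} (λ i → (k + y + 2) + toℕ i)
    regroup : ∀ k y q₁ q₂ z → 2 * (k + y + (q₁ + q₂)) + suc (y + z) ≡ 2 * (k + y) + 1 + ((2 * q₁ + y) + (2 * q₂ + z))
    regroup = solve-∀
    collect : ∀ k y z → 2 * (k + y) + 1 + ((2 * (y * k) + y * y) + (2 * (z * (k + y + 2)) + z * z))
              ≡ suc (y + z) * suc (y + z) + 2 * (k * suc (y + z) + z)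
    collect = solve-∀

  M N : ℕ
  M = T * (k + y + P) + e + a * suc T
  N = T * (k + y + Q) + f + b * suc T

  M≡X : M ≡ X
  M≡X = ℕ.*-cancelˡ-≡ M X 2 (begin-equality
    2 * M                                                     ≡⟨ expand T (k + y + P) e a ⟩
    T * (2 * (k + y + P) + a * 2) + 2 * e + a * 2             ≡⟨ cong (λ A → T * (2 * (k + y + P) + A) + 2 * e + a * 2) A≡ ⟨
    T * (2 * (k + y + P) + A) + 2 * e + a * 2                 ≡⟨ cong (λ v → T * v + 2 * e + a * 2) 2P≡ ⟩
    T * (A * A + 2 * (j * B + y)) + 2 * e + a * 2             ≡⟨ cong₂ (λ A B → T * (A * A + 2 * (j * B + y)) + 2 * e + a * 2) A≡ B≡ ⟩
    T * (a * 2 * (a * 2) + 2 * (j * (b * 2) + y)) + 2 * e + a * 2 ≡⟨ collect T a (j * (b * 2) + y) e ⟩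
    2 * (T * (j * (b * 2) + y) + e + (a + 2 * (T * (a * a)))) ≡⟨ cong (2 *_) excess ⟩
    2 * X                                                     ∎)
    where
    expand : ∀ T p e a → 2 * (T * p + e + a * suc T) ≡ T * (2 * p + a * 2) + 2 * e + a * 2
    expand = solve-∀
    collect : ∀ T a Y e → T * (a * 2 * (a * 2) + 2 * Y) + 2 * e + a * 2 ≡ 2 * (T * Y + e + (a + 2 * (T * (a * a))))
    collect = solve-∀

  -- The two sets of a row have `1 / T` of the grand total, whatever the layout, so only the m-side
  -- has to be compared with `X` directly.
  M+N≡2X : 2 * (M + N) ≡ 2 * (X + X)
  M+N≡2X = begin-equality
    2 * (M + N)
      ≡⟨ expand T (k + y + P) (k + y + Q) e f a b ⟩
    T * ((2 * (k + y + P) + a * 2) + (2 * (k + y + Q) + b * 2)) + 2 * (e + f) + (a * 2 + b * 2)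
      ≡⟨ cong₂ (λ A B → T * ((2 * (k + y + P) + A) + (2 * (k + y + Q) + B)) + 2 * (e + f) + (A + B)) A≡ B≡ ⟨
    T * ((2 * (k + y + P) + A) + (2 * (k + y + Q) + B)) + 2 * (e + f) + (A + B)
      ≡⟨ cong₂ (λ v w → T * (v + w) + 2 * T + (A + B)) 2P≡ 2Q≡ ⟩
    T * ((A * A + 2 * (j * B + y)) + (B * B + 2 * (k * B + z))) + 2 * T + (A + B)
      ≡⟨ square T k j y z ⟩
    T * ((A + B) * (A + B)) + (A + B)
      ≡⟨ cong (λ v → T * (v * v) + v) A+B≡4s ⟩
    T * (4 * s * (4 * s)) + 4 * s
      ≡⟨ collect T s ⟩
    2 * (X + X) ∎
    where
    expand : ∀ T p q e f a b → 2 * ((T * p + e + a * suc T) + (T * q + f + b * suc T))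
             ≡ T * ((2 * p + a * 2) + (2 * q + b * 2)) + 2 * (e + f) + (a * 2 + b * 2)
    expand = solve-∀
    square : ∀ T k j y z →
             T * ((suc (k + j) * suc (k + j) + 2 * (j * suc (y + z) + y))
                  + (suc (y + z) * suc (y + z) + 2 * (k * suc (y + z) + z))) + 2 * T + (suc (k + j) + suc (y + z))
             ≡ T * ((suc (k + j) + suc (y + z)) * (suc (k + j) + suc (y + z))) + (suc (k + j) + suc (y + z))
    square = solve-∀
    A+B≡4s : A + B ≡ 4 * s
    A+B≡4s = begin-equality
      A + B         ≡⟨ cong₂ _+_ A≡ B≡ ⟩
      a * 2 + b * 2 ≡⟨ ℕ.*-distribʳ-+ 2 a b ⟨
      (a + b) * 2   ≡⟨ cong (_* 2) a+b≡2s ⟩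
      2 * s * 2     ≡⟨ double s ⟩
      4 * s         ∎
      where
      double : ∀ s → 2 * s * 2 ≡ 4 * s
      double = solve-∀
    collect : ∀ T s → T * (4 * s * (4 * s)) + 4 * s ≡ 2 * (s * (4 * (T * s) + 1) + s * (4 * (T * s) + 1))
    collect = solve-∀

  N≡X : N ≡ X
  N≡X = ℕ.+-cancelˡ-≡ X N X (trans (cong (_+ N) (sym M≡X)) (ℕ.*-cancelˡ-≡ (M + N) (X + X) 2 M+N≡2X))

-- Neighbourhood sums in the graph constructions

sum-splitAt : ∀ m n (f : Fin m ⊎ Fin n → ℕ) →
              sum (f ∘ splitAt m {n}) ≡ sum (f ∘ inj₁) + sum (f ∘ inj₂)
sum-splitAt m n f = trans (sum-+ m (f ∘ splitAt m)) (cong₂ _+_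
  (sum-cong-≗ λ i → cong f (splitAt-↑ˡ m i n))
  (sum-cong-≗ λ i → cong f (splitAt-↑ʳ m n i)))

sum-combine : ∀ m n (f : Fin (m * n) → ℕ) → sum f ≡ sum (λ i → sum (λ j → f (combine {m} {n} i j)))
sum-combine zero    n f = refl
sum-combine (suc m) n f = trans (sum-+ n f) (cong (_+_ (sum (λ j → f (j ↑ˡ (m * n))))) (sum-combine m n (f ∘ (n ↑ʳ_))))

sum-remQuot : ∀ m n (f : Fin m × Fin n → ℕ) → sum (f ∘ remQuot {m} n) ≡ sum (λ i → sum (λ j → f (i , j)))
sum-remQuot m n f = trans (sum-combine m n (f ∘ remQuot {m} n))
  (sum-cong-≗ λ i → sum-cong-≗ λ j → cong f (remQuot-combine i j))

bit : Bool → ℕ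
bit b = if b then 1 else 0

bit-∧ : ∀ a b x → bit (a ∧ b) * x ≡ bit a * (bit b * x)
bit-∧ false b x = refl
bit-∧ true  b x = sym (ℕ.+-identityʳ (bit b * x))

sum-δ : ∀ {n} (i : Fin n) (f : Fin n → ℕ) → sum (λ j → bit (does (i ≟ j)) * f j) ≡ f i
sum-δ {suc n} zero    f = trans (cong₂ _+_ (ℕ.*-identityˡ (f zero)) (sum-replicate-zero n)) (ℕ.+-identityʳ (f zero))
sum-δ {suc n} (suc i) f = sum-δ i (f ∘ suc)

module _ {A : Set} where

  sum-filter : ∀ {P : A → Set} (P? : Decidable P) (f : A → ℕ) xs →
               List.sum (map f (filter P? xs)) ≡ List.sum (map (λ x → bit (does (P? x)) * f x) xs)
  sum-filter P? f []       = refl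
  sum-filter P? f (x ∷ xs) with does (P? x)
  ... | true  = cong₂ _+_ (sym (ℕ.*-identityˡ (f x))) (sum-filter P? f xs)
  ... | false = sum-filter P? f xs

  sum-map-const : ∀ (f : A → ℕ) c → (∀ x → f x ≡ c) → ∀ xs → List.sum (map f xs) ≡ length xs * c
  sum-map-const f c f≡c []       = refl
  sum-map-const f c f≡c (x ∷ xs) = cong₂ _+_ (f≡c x) (sum-map-const f c f≡c xs)

  sum-map-comm : ∀ {n} (f : Fin n → A → ℕ) xs →
                 sum (λ i → List.sum (map (f i) xs)) ≡ List.sum (map (λ x → sum (λ i → f i x)) xs)
  sum-map-comm {n} f []       = sum-replicate-zero n
  sum-map-comm     f (x ∷ xs) = trans (∑-distrib-+ (λ i → f i x) (λ i → List.sum (map (f i) xs)))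
                                      (cong (_+_ (sum (λ i → f i x))) (sum-map-comm f xs))

sum-tabulate : ∀ {n} (f : Fin n → ℕ) → List.sum (tabulate f) ≡ sum f
sum-tabulate {zero}  f = refl
sum-tabulate {suc n} f = cong (_+_ (f zero)) (sum-tabulate (f ∘ suc))

∑V : ∀ {v} (G : Graph v) → (V G → ℕ) → ℕ
∑V G f = sum (f ∘ Inverse.from (index G))

∑N : ∀ {v} (G : Graph v) → V G → (V G → ℕ) → ℕ
∑N G x f = List.sum (map f (neighbours G x))

adjacent : ∀ {v} (G : Graph v) → V G → V G → ℕ
adjacent G x y = bit (does (_~?_ G x y))

-- Indicators replace filters because adjacency in `⊗` and in `·` is a conjunction, whose indicator
-- factorises by `bit-∧`.
∑N-as-∑V : ∀ {v} (G : Graph v) x f → ∑N G x f ≡ ∑V G (λ y → adjacent G x y * f y)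
∑N-as-∑V {v} G x f = begin-equality
  ∑N G x f                              ≡⟨ sum-filter (_~?_ G x) f (vertices G) ⟩
  List.sum (map g (map from (allFin v))) ≡⟨ cong (List.sum ∘ map g) (map-tabulate (λ i → i) from) ⟩
  List.sum (map g (tabulate from))      ≡⟨ cong List.sum (map-tabulate from g) ⟩
  List.sum (tabulate (g ∘ from))        ≡⟨ sum-tabulate (g ∘ from) ⟩
  ∑V G g                                ∎
  where
  from = Inverse.from (index G)
  g = λ y → adjacent G x y * f y

∑V-*ˡ : ∀ {v} (G : Graph v) c f → c * ∑V G f ≡ ∑V G (λ x → c * f x)
∑V-*ˡ G c f = *-distribˡ-sum c (f ∘ Inverse.from (index G))

∑V-cong : ∀ {v} (G : Graph v) {f g} → (∀ x → f x ≡ g x) → ∑V G f ≡ ∑V G g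
∑V-cong G f≗g = sum-cong-≗ (f≗g ∘ Inverse.from (index G))

∑N-⊗ : ∀ {v w} (G : Graph v) (H : Graph w) g h f →
       ∑N (G ⊗ H) (g , h) f ≡ ∑N G g (λ g′ → ∑N H h (λ h′ → f (g′ , h′)))
∑N-⊗ {v} {w} G H g h f = begin-equality
  ∑N (G ⊗ H) (g , h) f
    ≡⟨ ∑N-as-∑V (G ⊗ H) (g , h) f ⟩
  ∑V (G ⊗ H) (λ x → adjacent (G ⊗ H) (g , h) x * f x)
    ≡⟨ sum-remQuot v w (λ (i , j) → let x = Inverse.from (index G) i , Inverse.from (index H) j in adjacent (G ⊗ H) (g , h) x * f x) ⟩
  ∑V G (λ g′ → ∑V H (λ h′ → adjacent (G ⊗ H) (g , h) (g′ , h′) * f (g′ , h′)))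
    ≡⟨ ∑V-cong G (λ g′ → ∑V-cong H (λ h′ → bit-∧ (does (_~?_ G g g′)) (does (_~?_ H h h′)) (f (g′ , h′)))) ⟩
  ∑V G (λ g′ → ∑V H (λ h′ → adjacent G g g′ * (adjacent H h h′ * f (g′ , h′))))
    ≡⟨ ∑V-cong G (λ g′ → ∑V-*ˡ H (adjacent G g g′) (λ h′ → adjacent H h h′ * f (g′ , h′))) ⟨
  ∑V G (λ g′ → adjacent G g g′ * ∑V H (λ h′ → adjacent H h h′ * f (g′ , h′)))
    ≡⟨ ∑V-cong G (λ g′ → cong (adjacent G g g′ *_) (∑N-as-∑V H h (λ h′ → f (g′ , h′)))) ⟨
  ∑V G (λ g′ → adjacent G g g′ * ∑N H h (λ h′ → f (g′ , h′)))
    ≡⟨ ∑N-as-∑V G g (λ g′ → ∑N H h (λ h′ → f (g′ , h′))) ⟨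
  ∑N G g (λ g′ → ∑N H h (λ h′ → f (g′ , h′))) ∎

∑N-· : ∀ {v} t (H : Graph v) i x f → ∑N (t · H) (i , x) f ≡ ∑N H x (λ y → f (i , y))
∑N-· {v} t H i x f = begin-equality
  ∑N (t · H) (i , x) f
    ≡⟨ ∑N-as-∑V (t · H) (i , x) f ⟩
  ∑V (t · H) (λ y → adjacent (t · H) (i , x) y * f y)
    ≡⟨ sum-remQuot t v (λ (j , k) → let y = j , Inverse.from (index H) k in adjacent (t · H) (i , x) y * f y) ⟩
  sum (λ j → ∑V H (λ y → adjacent (t · H) (i , x) (j , y) * f (j , y)))
    ≡⟨ sum-cong-≗ (λ j → ∑V-cong H (λ y → bit-∧ (does (i ≟ j)) (does (_~?_ H x y)) (f (j , y)))) ⟩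
  sum (λ j → ∑V H (λ y → bit (does (i ≟ j)) * (adjacent H x y * f (j , y))))
    ≡⟨ sum-cong-≗ (λ j → ∑V-*ˡ H (bit (does (i ≟ j))) (λ y → adjacent H x y * f (j , y))) ⟨
  sum (λ j → bit (does (i ≟ j)) * ∑V H (λ y → adjacent H x y * f (j , y)))
    ≡⟨ sum-δ i (λ j → ∑V H (λ y → adjacent H x y * f (j , y))) ⟩
  ∑V H (λ y → adjacent H x y * f (i , y))
    ≡⟨ ∑N-as-∑V H x (λ y → f (i , y)) ⟨
  ∑N H x (λ y → f (i , y)) ∎

∑N-K₁ : ∀ m n i f → ∑N (K m n) (inj₁ i) f ≡ sum (f ∘ inj₂)
∑N-K₁ m n i f = begin-equality
  ∑N (K m n) (inj₁ i) f                                      ≡⟨ ∑N-as-∑V (K m n) (inj₁ i) f ⟩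
  ∑V (K m n) (λ y → adjacent (K m n) (inj₁ i) y * f y)       ≡⟨ sum-splitAt m n (λ y → adjacent (K m n) (inj₁ i) y * f y) ⟩
  sum {m} (λ _ → 0) + sum (λ j → 1 * f (inj₂ j))             ≡⟨ cong₂ _+_ (sum-replicate-zero m) (sum-cong-≗ (λ j → ℕ.*-identityˡ (f (inj₂ j)))) ⟩
  sum (f ∘ inj₂)                                             ∎

∑N-K₂ : ∀ m n i f → ∑N (K m n) (inj₂ i) f ≡ sum (f ∘ inj₁)
∑N-K₂ m n i f = begin-equality
  ∑N (K m n) (inj₂ i) f                                      ≡⟨ ∑N-as-∑V (K m n) (inj₂ i) f ⟩
  ∑V (K m n) (λ y → adjacent (K m n) (inj₂ i) y * f y)       ≡⟨ sum-splitAt m n (λ y → adjacent (K m n) (inj₂ i) y * f y) ⟩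
  sum (λ j → 1 * f (inj₁ j)) + sum {n} (λ _ → 0)             ≡⟨ cong₂ _+_ (sum-cong-≗ (λ j → ℕ.*-identityˡ (f (inj₁ j)))) (sum-replicate-zero n) ⟩
  sum (f ∘ inj₁) + 0                                         ≡⟨ ℕ.+-identityʳ _ ⟩
  sum (f ∘ inj₁)                                             ∎

-- The vertex `((i , x) , g)` gets the label in column `x` of row `(i , g)`. Its neighbours are the
-- columns of the other side in the rows `(i , g′)` with `g′` adjacent to `g`: there are `d` such
-- rows, each with sum `c`.
split⇒distanceMagic : ∀ {p} t m n (G : Graph p) → Regular G →
                      EqualSumSplit (t * p) m n → DistanceMagic (t · K m n ⊗ G)
split⇒distanceMagic {p} t m n G (d , regular) (φ , c , sum-m , sum-n) = ↔⇒⤖ f , d * c , magic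
  where
  rearrange : ((Fin t × (Fin m ⊎ Fin n)) × V G) ↔ ((Fin m ⊎ Fin n) × (Fin t × V G))
  rearrange = mk↔ₛ′ (λ ((i , x) , g) → x , (i , g)) (λ (x , (i , g)) → (i , x) , g) (λ _ → refl) (λ _ → refl)

  size : (m + n) * (t * p) ≡ t * (m + n) * p
  size = lemma (m + n) t p
    where
    lemma : ∀ k t p → k * (t * p) ≡ t * k * p
    lemma = solve-∀

  f : V (t · K m n ⊗ G) ↔ Fin (t * (m + n) * p)
  f = ↔-trans rearrange (↔-trans (↔-refl ×-↔ ↔-trans (↔-refl ×-↔ index G) (↔-sym *↔×)) (↔-trans φ (cast-id size)))

  label : V (t · K m n ⊗ G) → ℕ
  label x = suc (toℕ (Inverse.to f x))

  label-row : ∀ i x g → label ((i , x) , g) ≡ suc (toℕ (Inverse.to φ (x , combine i (Inverse.to (index G) g))))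
  label-row i x g = cong suc (toℕ-cast size _)

  regular-sum : ∀ {k} (ℓ : Fin k → V G → ℕ) → (∀ g → sum (λ j → ℓ j g) ≡ c) →
                ∀ g → sum (λ j → ∑N G g (ℓ j)) ≡ d * c
  regular-sum ℓ ℓ-sum g = begin-equality
    sum (λ j → ∑N G g (ℓ j))          ≡⟨ sum-map-comm ℓ (neighbours G g) ⟩
    ∑N G g (λ g′ → sum (λ j → ℓ j g′)) ≡⟨ sum-map-const _ c ℓ-sum (neighbours G g) ⟩
    degree G g * c                    ≡⟨ cong (_* c) (regular g) ⟩
    d * c                             ∎

  magic : ∀ x → ∑N (t · K m n ⊗ G) x label ≡ d * c
  magic ((i , x) , g) = trans (∑N-⊗ (t · K m n) G (i , x) g label)
    (trans (∑N-· t (K m n) i x (λ y → ∑N G g (λ g′ → label (y , g′)))) (side x))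
    where
    side : ∀ x → ∑N (K m n) x (λ y → ∑N G g (λ g′ → label ((i , y) , g′))) ≡ d * c
    side (inj₁ x) = trans (∑N-K₁ m n x (λ y → ∑N G g (λ g′ → label ((i , y) , g′))))
      (regular-sum (λ j g′ → label ((i , inj₂ j) , g′))
        (λ g′ → trans (sum-cong-≗ (λ j → label-row i (inj₂ j) g′)) (sum-n (combine i (Inverse.to (index G) g′)))) g)
    side (inj₂ x) = trans (∑N-K₂ m n x (λ y → ∑N G g (λ g′ → label ((i , y) , g′))))
      (regular-sum (λ j g′ → label ((i , inj₁ j) , g′))
        (λ g′ → trans (sum-cong-≗ (λ j → label-row i (inj₁ j) g′)) (sum-m (combine i (Inverse.to (index G) g′)))) g)

-- Reaching half of the total

-- Division with a remainder that may be as large as `T`, so that the quotient stays below `suc W`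
-- even for `E = T * suc W`.
bounded-div : ∀ T W E → E ≤ T * suc W →
              ∃[ Y ] ∃[ e ] ∃[ f ] Y < suc W × T ≡ e + f × E ≡ T * Y + e
bounded-div T W E E≤ with E ≤? T * W
bounded-div T zero E E≤ | yes E≤0 = 0 , 0 , T , s≤s z≤n , refl ,
  trans (ℕ.n≤0⇒n≡0 (subst (E ≤_) (ℕ.*-zeroʳ T) E≤0)) (sym (trans (ℕ.+-identityʳ (T * 0)) (ℕ.*-zeroʳ T)))
bounded-div T (suc W) E E≤ | yes E≤′ =
  let Y , e , f , Y< , T≡ , E≡ = bounded-div T W E E≤′
  in Y , e , f , ℕ.m≤n⇒m≤1+n Y< , T≡ , E≡
bounded-div T W E E≤ | no E≰ =
  let e , E≡ = ℕ.m≤n⇒∃[o]m+o≡n (ℕ.<⇒≤ (ℕ.≰⇒> E≰))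
      f , T≡ = ℕ.m≤n⇒∃[o]m+o≡n (ℕ.+-cancelˡ-≤ (T * W) e T
                 (subst₂ _≤_ (sym E≡) (trans (ℕ.*-suc T W) (ℕ.+-comm T (T * W))) E≤))
  in W , e , f , ℕ.≤-refl , sym T≡ , sym E≡

-- The m-side gets its least possible sum with the lowest runs and its greatest one
-- with the highest runs, T * (4 a b) more; the required sum lies E above the least.
equal-sum-split : ∀ T a b s → 1 ≤ a → a ≤ b → a + b ≡ 2 * s →
                  2 * (T * (b * b)) + b ≤ 2 * (T * (a * a)) + 4 * (T * (a * b)) + a →
                  EqualSumSplit T (a * 2) (b * 2)
equal-sum-split T (suc zero) (suc zero) s _ _ 2≡2s _ =
  -- The m-side takes the first and the last of four runs, the n-side the middle two. With `e` equal
  -- to `T` no run is cut, as the case `b ≡ 1` requires.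
  split-from-layout 1 1 s 1 0 1 0 T 0 (sym (ℕ.+-identityʳ T)) refl refl (inj₂ (refl , refl)) 2≡2s
    (subst (λ s → T * (0 * 2 + 1) + T + (1 + 2 * (T * 1)) ≡ s * (4 * (T * s) + 1))
           (ℕ.*-cancelˡ-≡ 1 s 2 2≡2s) (identity T))
  where
  identity : ∀ T → T * (0 * 2 + 1) + T + (1 + 2 * (T * 1)) ≡ 1 * (4 * (T * 1) + 1)
  identity = solve-∀
equal-sum-split T (suc (suc _)) (suc zero) _ _ (s≤s ()) _ _
equal-sum-split T a@(suc a′) b@(suc (suc b′)) s _ a≤b a+b≡2s bound =
  split-from-layout a b s k j y z e f T≡ (sym (trans A≡ (cong suc (ℕ.+-comm j k)))) (sym B≡)
    (inj₁ (s≤s (s≤s z≤n))) a+b≡2s (begin-equality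
      T * (j * (b * 2) + y) + e + least ≡⟨ cong (λ Y → T * Y + e + least) Y≡ ⟨
      T * Y + e + least                 ≡⟨ cong (_+ least) E≡ ⟨
      E + least                         ≡⟨ ℕ.+-comm E least ⟩
      least + E                         ≡⟨ least+E≡X ⟩
      X                                 ∎)
  where
  X least : ℕ
  X = s * (4 * (T * s) + 1)
  least = a + 2 * (T * (a * a))

  a≤s : a ≤ s
  a≤s = ℕ.*-cancelˡ-≤ 2 (begin
    2 * a ≡⟨ cong (_+_ a) (ℕ.+-identityʳ a) ⟩
    a + a ≤⟨ ℕ.+-monoʳ-≤ a a≤b ⟩
    a + b ≡⟨ a+b≡2s ⟩
    2 * s ∎)

  least≤X : least ≤ X
  least≤X = begin
    a + 2 * (T * (a * a)) ≤⟨ ℕ.+-mono-≤ a≤s (ℕ.*-monoʳ-≤ 2 (ℕ.*-monoʳ-≤ T (ℕ.*-mono-≤ a≤s a≤s))) ⟩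
    s + 2 * (T * (s * s)) ≤⟨ ℕ.m≤m+n _ (2 * (T * (s * s))) ⟩
    s + 2 * (T * (s * s)) + 2 * (T * (s * s)) ≡⟨ collect T s ⟩
    X ∎
    where
    collect : ∀ T s → s + 2 * (T * (s * s)) + 2 * (T * (s * s)) ≡ s * (4 * (T * s) + 1)
    collect = solve-∀

  E : ℕ
  E = proj₁ (ℕ.m≤n⇒∃[o]m+o≡n least≤X)

  least+E≡X : least + E ≡ X
  least+E≡X = proj₂ (ℕ.m≤n⇒∃[o]m+o≡n least≤X)

  E≤ : E ≤ T * (a * 2 * (b * 2))
  -- `2 * X` is the total of a row. Replacing its terms in `b` alone by means of `bound` leaves
  -- twice the greatest sum of the m-side.
  E≤ = ℕ.*-cancelˡ-≤ 2 (ℕ.+-cancelˡ-≤ (2 * least) _ _ (begin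
    2 * least + 2 * E
      ≡⟨ ℕ.*-distribˡ-+ 2 least E ⟨
    2 * (least + E)
      ≡⟨ cong (2 *_) least+E≡X ⟩
    2 * X
      ≡⟨ halve T s ⟩
    2 * s * (2 * (T * (2 * s)) + 1)
      ≡⟨ cong (λ v → v * (2 * (T * v) + 1)) a+b≡2s ⟨
    (a + b) * (2 * (T * (a + b)) + 1)
      ≡⟨ expand T a b ⟩
    (2 * (T * (b * b)) + b) + (2 * (T * (a * a)) + 4 * (T * (a * b)) + a)
      ≤⟨ ℕ.+-monoˡ-≤ _ bound ⟩
    (2 * (T * (a * a)) + 4 * (T * (a * b)) + a) + (2 * (T * (a * a)) + 4 * (T * (a * b)) + a)
      ≡⟨ collect T a b ⟩
    2 * least + 2 * (T * (a * 2 * (b * 2))) ∎))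
    where
    halve : ∀ T s → 2 * (s * (4 * (T * s) + 1)) ≡ 2 * s * (2 * (T * (2 * s)) + 1)
    halve = solve-∀
    expand : ∀ T a b → (a + b) * (2 * (T * (a + b)) + 1)
             ≡ (2 * (T * (b * b)) + b) + (2 * (T * (a * a)) + 4 * (T * (a * b)) + a)
    expand = solve-∀
    collect : ∀ T a b → (2 * (T * (a * a)) + 4 * (T * (a * b)) + a) + (2 * (T * (a * a)) + 4 * (T * (a * b)) + a)
              ≡ 2 * (a + 2 * (T * (a * a))) + 2 * (T * (a * 2 * (b * 2)))
    collect = solve-∀

  division : ∃[ Y ] ∃[ e ] ∃[ f ] Y < a * 2 * (b * 2) × T ≡ e + f × E ≡ T * Y + e
  division = bounded-div T _ E E≤

  Y e f : ℕ
  Y = proj₁ division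
  e = proj₁ (proj₂ division)
  f = proj₁ (proj₂ (proj₂ division))

  Y< : Y < a * 2 * (b * 2)
  Y< = proj₁ (proj₂ (proj₂ (proj₂ division)))

  T≡ : T ≡ e + f
  T≡ = proj₁ (proj₂ (proj₂ (proj₂ (proj₂ division))))

  E≡ : E ≡ T * Y + e
  E≡ = proj₂ (proj₂ (proj₂ (proj₂ (proj₂ division))))

  j y : ℕ
  -- The quotient counts the runs that have passed the whole n-side, the remainder the runs of the
  -- n-side below the sliding run. `Y<` gives `j < a * 2`, which leaves room for the sliding run
  -- itself.
  j = Y / (b * 2)
  y = Y % (b * 2)

  Y≡ : Y ≡ j * (b * 2) + y
  Y≡ = trans (m≡m%n+[m/n]*n Y (b * 2)) (ℕ.+-comm y (j * (b * 2)))

  k z : ℕ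
  k = proj₁ (ℕ.m≤n⇒∃[o]m+o≡n (m<n*o⇒m/o<n {Y} {a * 2} {b * 2} Y<))
  z = proj₁ (ℕ.m≤n⇒∃[o]m+o≡n (m%n<n Y (b * 2)))

  A≡ : a * 2 ≡ suc (j + k)
  A≡ = sym (proj₂ (ℕ.m≤n⇒∃[o]m+o≡n (m<n*o⇒m/o<n {Y} {a * 2} {b * 2} Y<)))

  B≡ : b * 2 ≡ suc (y + z)
  B≡ = sym (proj₂ (ℕ.m≤n⇒∃[o]m+o≡n (m%n<n Y (b * 2))))

-- Condition (ii) as an inequality of natural numbers

/-cancel-< : ∀ a b c d → + a ℚ./ suc b ℚ.< + c ℚ./ suc d → a * suc d < c * suc b
/-cancel-< a b c d a/b<c/d = ℕ.≰⇒> λ cb≤ad →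
  ℚ.<-irrefl refl (ℚ.<-≤-trans a/b<c/d (/-mono-≤ c d a b cb≤ad))

-- If 2Q² ≥ R² + 2 then √2 Q exceeds R by more than 2/(4R + 4), which is the precision used below.
√2-bound : ∀ Q R → (∀ l → ∃[ N ] ∀ i → N ≤ i → root 2 i * (Q * suc l) < (R * suc l + 1) * suc i) →
           2 * (Q * Q) ≤ R * R + 1
√2-bound Q R approx with 2 * (Q * Q) ≤? R * R + 1
... | yes p = p
... | no ¬p = contradiction gap (ℕ.<⇒≱ (ℕ.*-cancelʳ-< (I * I) _ _ squares))
  where
  l L N i I r : ℕ
  l = 4 * R + 3
  L = suc l
  N = proj₁ (approx l)
  -- Replacing `r` by `suc r` costs `Q * L`, which is at most `I` for this choice.
  i = N ⊔ (Q * L)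
  I = suc i
  r = root 2 i

  close : suc r * (Q * L) < (R * L + 2) * I
  close = begin-strict
    suc r * (Q * L)       ≡⟨⟩
    Q * L + r * (Q * L)   <⟨ ℕ.+-mono-≤-< (ℕ.≤-trans (ℕ.m≤n⊔m N (Q * L)) (ℕ.n≤1+n i)) (proj₂ (approx l) i (ℕ.m≤m⊔n N (Q * L))) ⟩
    I + (R * L + 1) * I   ≡⟨ collect (R * L) I ⟩
    (R * L + 2) * I       ∎
    where
    collect : ∀ x I → I + (x + 1) * I ≡ (x + 2) * I
    collect = solve-∀

  squares : 2 * (Q * L * (Q * L)) * (I * I) < (R * L + 2) * (R * L + 2) * (I * I)
  squares = begin-strict
    2 * (Q * L * (Q * L)) * (I * I)          ≡⟨ commute (Q * L) I ⟩
    2 * (I * I) * (Q * L * (Q * L))          ≤⟨ ℕ.*-monoˡ-≤ (Q * L * (Q * L)) (ℕ.<⇒≤ (isqrt-upper (2 * (I * I)))) ⟩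
    suc r * suc r * (Q * L * (Q * L))        ≡⟨ square (suc r) (Q * L) ⟩
    suc r * (Q * L) * (suc r * (Q * L))      <⟨ ℕ.*-mono-< close close ⟩
    (R * L + 2) * I * ((R * L + 2) * I)      ≡⟨ square (R * L + 2) I ⟨
    (R * L + 2) * (R * L + 2) * (I * I)      ∎
    where
    commute : ∀ x I → 2 * (x * x) * (I * I) ≡ 2 * (I * I) * (x * x)
    commute = solve-∀
    square : ∀ x y → x * x * (y * y) ≡ x * y * (x * y)
    square = solve-∀

  gap : (R * L + 2) * (R * L + 2) ≤ 2 * (Q * L * (Q * L))
  gap = begin
    -- For `L = 4 * R + 4`, the polynomial added is `(R² + 2) L² - (R L + 2)² = 2 L² - 4 R L - 4`.
    (R * L + 2) * (R * L + 2)                                       ≤⟨ ℕ.m≤m+n _ (16 * (R * R) + 48 * R + 28) ⟩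
    (R * L + 2) * (R * L + 2) + (16 * (R * R) + 48 * R + 28)        ≡⟨ identity R ⟩
    suc (R * R + 1) * (L * L)                                       ≤⟨ ℕ.*-monoˡ-≤ (L * L) (ℕ.≰⇒> ¬p) ⟩
    2 * (Q * Q) * (L * L)                                           ≡⟨ square Q L ⟩
    2 * (Q * L * (Q * L))                                           ∎
    where
    identity : ∀ R → (R * suc (4 * R + 3) + 2) * (R * suc (4 * R + 3) + 2) + (16 * (R * R) + 48 * R + 28)
               ≡ suc (R * R + 1) * (suc (4 * R + 3) * suc (4 * R + 3))
    identity = solve-∀
    square : ∀ x y → 2 * (x * x) * (y * y) ≡ 2 * (x * y * (x * y))
    square = solve-∀

-- The hypothesis is `m ≥ (√2 - 1)(n + 1/D)`; multiplied by `D` and rearranged, it becomes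
-- `√2 Q ≤ R`.
real-bound : ∀ m n D .{{_ : NonZero D}} → fromℕ m ≥ℝ (√ 2 -ℝ 1ℝ) *ℝ fromℕ n +ℝ (√ 2 -ℝ 1ℝ) /ℝ D →
             let Q = D * n + 1; R = D * m + D * n + 1 in 2 * (Q * Q) ≤ R * R + 1
real-bound m n (suc d) m≥ = √2-bound (D * n + 1) (D * m + D * n + 1) approx
  where
  D : ℕ
  D = suc d

  module _ (l i : ℕ)
           (h : (√-approx 2 i ℚ.+ ℚ.- (+ 1 ℚ./ 1)) ℚ.* (+ n ℚ./ 1) ℚ.+ (√-approx 2 i ℚ.+ ℚ.- (+ 1 ℚ./ 1)) ℚ.* (+ 1 ℚ./ D)
                ℚ.< (+ m ℚ./ 1) ℚ.+ (+ 1 ℚ./ (D * suc l))) where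

    r I L : ℕ
    r = root 2 i
    I = suc i
    L = suc l

    α ν δ μ ε o : ℚ
    α = √-approx 2 i
    ν = + n ℚ./ 1
    δ = + 1 ℚ./ D
    μ = + m ℚ./ 1
    ε = + 1 ℚ./ (D * L)
    o = + 1 ℚ./ 1

    ν+δ : ν ℚ.+ δ ≡ + (n * D + 1 * 1) ℚ./ (1 * D)
    ν+δ = /-+ n 0 1 d

    -- Adding `o * (ν + δ)` to both sides removes the subtraction, leaving quotients of natural
    -- numbers only.
    positive-form : α ℚ.* (ν ℚ.+ δ) ℚ.< (μ ℚ.+ ε) ℚ.+ (ν ℚ.+ δ)
    positive-form = subst₂ ℚ._<_ (move α o ν δ) (cong ((μ ℚ.+ ε) ℚ.+_) (ℚ.*-identityˡ (ν ℚ.+ δ)))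
                      (ℚ.+-monoˡ-< (o ℚ.* (ν ℚ.+ δ)) h)
      where
      move : ∀ α o ν δ → (α ℚ.+ ℚ.- o) ℚ.* ν ℚ.+ (α ℚ.+ ℚ.- o) ℚ.* δ ℚ.+ o ℚ.* (ν ℚ.+ δ) ≡ α ℚ.* (ν ℚ.+ δ)
      move = solve 4 (λ α o ν δ → (α :+ (:- o)) :* ν :+ (α :+ (:- o)) :* δ :+ o :* (ν :+ δ) := α :* (ν :+ δ)) refl
        where open ℚSolver.+-*-Solver

    lhs : α ℚ.* (ν ℚ.+ δ) ≡ + (r * (n * D + 1 * 1)) ℚ./ (I * (1 * D))
    lhs = trans (cong (α ℚ.*_) ν+δ) (/-* r i (n * D + 1 * 1) (d + 0))

    numerator : ℕ
    numerator = (m * (D * L) + 1 * 1) * (1 * D) + (n * D + 1 * 1) * (1 * (D * L))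

    rhs : (μ ℚ.+ ε) ℚ.+ (ν ℚ.+ δ) ≡ + numerator ℚ./ (1 * (D * L) * (1 * D))
    rhs = trans (cong₂ ℚ._+_ (/-+ m 0 1 (l + d * L)) ν+δ)
                (/-+ (m * (D * L) + 1 * 1) (l + d * L + 0) (n * D + 1 * 1) (d + 0))

    integral : r * (n * D + 1 * 1) * (1 * (D * L) * (1 * D)) < numerator * (I * (1 * D))
    -- The denominators of `lhs` and `rhs` are passed as their predecessors, in the form to which
    -- they compute.
    integral = /-cancel-< (r * (n * D + 1 * 1)) (d + 0 + i * (1 * D)) numerator (d + 0 + (l + d * L + 0) * (1 * D))
                 (subst₂ ℚ._<_ lhs rhs positive-form)

    cleared : r * ((D * n + 1) * L) < ((D * m + D * n + 1) * L + 1) * I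
    cleared = ℕ.*-cancelʳ-< (D * D) _ _ (subst₂ _<_ (left r n D L) (right m n D L I) integral)
      where
      left : ∀ r n D L → r * (n * D + 1 * 1) * (1 * (D * L) * (1 * D)) ≡ r * ((D * n + 1) * L) * (D * D)
      left = solve-∀
      right : ∀ m n D L I → ((m * (D * L) + 1 * 1) * (1 * D) + (n * D + 1 * 1) * (1 * (D * L))) * (I * (1 * D))
              ≡ ((D * m + D * n + 1) * L + 1) * I * (D * D)
      right = solve-∀

  approx : ∀ l → ∃[ N ] ∀ i → N ≤ i →
           root 2 i * ((D * n + 1) * suc l) < ((D * m + D * n + 1) * suc l + 1) * suc i
  -- The precision `1 / (D * suc l)` becomes `1 / suc l` once `D` is cleared.
  approx l = let N , h = m≥ (+ 1 ℚ./ (D * suc l)) (/-mono-< 0 0 1 (l + d * suc l) (s≤s z≤n))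
             in N , λ i N≤i → cleared l i (h i N≤i)

difference-bound : ∀ x y → + 1 ≡ + x -ℤ + y → x ≤ y + 1
difference-bound x y 1≡x-y = ℕ.≤-reflexive (trans (sym (ℤ.+-injective y+1≡x)) (ℕ.+-comm 1 y))
  where
  y+1≡x : + (1 + y) ≡ + x
  y+1≡x = trans (cong (ℤ._+ + y) 1≡x-y) (trans (ℤ.+-assoc (+ x) (ℤ.- (+ y)) (+ y))
            (trans (cong (ℤ._+_ (+ x)) (ℤ.+-inverseˡ (+ y))) (ℤ.+-identityʳ (+ x))))

-- Both sides contain `16 T² b² + 8 T b + 2`, and the rest is divisible by `8 T`. What remains says
-- that half of the total of a row is at most the greatest sum of the m-side.
clear-squares : ∀ p t a b .{{_ : NonZero p}} .{{_ : NonZero t}} →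
                let D = 2 * p * t; Q = D * (b * 2) + 1; R = D * (a * 2) + D * (b * 2) + 1; T = t * p in
                2 * (Q * Q) ≤ R * R + 1 →
                2 * (T * (b * b)) + b ≤ 2 * (T * (a * a)) + 4 * (T * (a * b)) + a
clear-squares p t a b h = ℕ.*-cancelˡ-≤ (8 * (t * p)) {{m*n≢0 8 (t * p) {{_}} {{m*n≢0 t p}}}}
  (ℕ.+-cancelˡ-≤ (16 * (t * p * (t * p) * (b * b)) + 8 * (t * p * b) + 2) _ _
    (subst₂ _≤_ (left p t b) (right p t a b) h))
  where
  left : ∀ p t b → 2 * ((2 * p * t * (b * 2) + 1) * (2 * p * t * (b * 2) + 1))
         ≡ (16 * (t * p * (t * p) * (b * b)) + 8 * (t * p * b) + 2) + 8 * (t * p) * (2 * (t * p * (b * b)) + b)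
  left = solve-∀
  right : ∀ p t a b → (2 * p * t * (a * 2) + 2 * p * t * (b * 2) + 1) * (2 * p * t * (a * 2) + 2 * p * t * (b * 2) + 1) + 1
          ≡ (16 * (t * p * (t * p) * (b * b)) + 8 * (t * p * b) + 2)
            + 8 * (t * p) * (2 * (t * p * (a * a)) + 4 * (t * p * (a * b)) + a)
  right = solve-∀

-- Distance magic labelling from conditions (i) and (ii)

theorem20 : (p t m n : ℕ) .{{p≢0 : NonZero p}} .{{t≢0 : NonZero t}} .{{m≢0 : NonZero m}} .{{n≢0 : NonZero n}} →
    2 ∣ m → 2 ∣ n → m ≤ n →
    (G : Graph p) → Regular G →
    (m + n) % 4 ≡ 0 →
    ( + 1 ≡ + (2 * (2 * p * t * n + 1) ^ 2) -ℤ + ((2 * p * t * m + 2 * p * t * n + 1) ^ 2)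
    ⊎ fromℕ m ≥ℝ (√ 2 -ℝ 1ℝ) *ℝ fromℕ n +ℝ _/ℝ_ (√ 2 -ℝ 1ℝ) (2 * p * t) {{m*n≢0 (2 * p) t {{m*n≢0 2 p}}}} ) →
    DistanceMagic (t · K m n ⊗ G)
theorem20 p t m n (divides a refl) (divides b refl) m≤n G regular 4∣m+n condition =
  split⇒distanceMagic t m n G regular
    (equal-sum-split (t * p) a b s 1≤a (ℕ.*-cancelʳ-≤ a b 2 m≤n) a+b≡2s
      (clear-squares p t a b (bound condition)))
  where
  D Q R : ℕ
  D = 2 * p * t
  Q = D * n + 1
  R = D * m + D * n + 1

  1≤a : 1 ≤ a
  1≤a = ℕ.*-cancelʳ-< 2 0 a (>-nonZero⁻¹ m)

  s : ℕ
  -- Condition (i) makes `a + b` even, so that half of the total of a row,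
  -- `(a + b) * (2 * T * (a + b) + 1)` with `T = t * p`, is an integer.
  s = _∣_.quotient (m%n≡0⇒n∣m (m + n) 4 4∣m+n)

  a+b≡2s : a + b ≡ 2 * s
  a+b≡2s = ℕ.*-cancelʳ-≡ (a + b) (2 * s) 2 (begin-equality
    (a + b) * 2   ≡⟨ ℕ.*-distribʳ-+ 2 a b ⟩
    m + n         ≡⟨ _∣_.equality (m%n≡0⇒n∣m (m + n) 4 4∣m+n) ⟩
    s * 4         ≡⟨ double s ⟩
    2 * s * 2     ∎)
    where
    double : ∀ s → s * 4 ≡ 2 * s * 2
    double = solve-∀

  square : ∀ x → x ^ 2 ≡ x * x
  square x = cong (x *_) (ℕ.*-identityʳ x)

  bound : _ → 2 * (Q * Q) ≤ R * R + 1
  -- The equation puts `√2 Q` just above `R`; the `+ 1` in the bound admits this case.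
  bound (inj₁ eq) = subst₂ (λ x y → 2 * x ≤ y + 1) (square Q) (square R) (difference-bound (2 * Q ^ 2) (R ^ 2) eq)
  bound (inj₂ m≥) = real-bound m n D {{m*n≢0 (2 * p) t {{m*n≢0 2 p}}}} m≥
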